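{- Let $N\ge1$ be an integer. (1) For all $x\in[0,1]\setminus\mathbb{Q}$, $\widehat\omega(x,N)$ is $N$-balanced. Furthermore, for every $N\ge2$ there are uncountably many $x\in[0,1]\setminus\mathbb{Q}$ such that $\widehat\omega(x,N)$ is $2$-balanced. (2) For all $x\in[0,1]\setminus\mathbb{Q}$, $\omega(x,N)$ is $N^2$-balanced. Furthermore, for every $N\ge2$ there are uncountably many $x\in[0,1]\setminus\mathbb{Q}$ such that $\omega(x,N)$ is $2N$-balanced.
   Context: Let $N\ge 1$ be an integer and define $T_N:[0,1]\to[0,1]$ by $T_N(x)=\frac{N}{x}-\lfloor\frac{N}{x}\rfloor$ for $x\ne0$ and $T_N(0)=0$. For $x\in[0,1]\setminus\mathbb{Q}$ the (greedy) NCF digits of $x$ are $d_n=\lfloor N/T_N^{n-1}(x)\rfloor\ge N$, $n\ge1$; one writes $x=[0;d_1,d_2,\ldots]_N$. Every integer sequence $(d_n)_{n\geq 1}$ with $d_n\ge N$ occurs for exactly one irrational $x\in[0,1]$. A substitution on $\{0,1\}$ is given by images of the letters (nonempty words) and extends to finite and infinite words by concatenation. For $x=[0;d_1,d_2,\ldots]_N$ irrational let $\sigma_n(0)=0^{d_n}1^N$, $\sigma_n(1)=0$ and $\widehat\sigma_n(0)=0^{d_n}1$, $\widehat\sigma_n(1)=0^N$ for $n\ge1$. The NCF sequence $\omega(x,N)\in\{0,1\}^{\mathbb N}$ is the unique infinite word $\omega$ for which there exist $\omega^{(1)},\omega^{(2)},\ldots\in\{0,1\}^{\mathbb{N}}$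 with $\omega^{(1)}=\omega$ and $\omega^{(n)}=\sigma_n(\omega^{(n+1)})$ for all $n\ge1$. The dual NCF sequence $\widehat\omega(x,N)$ is defined in the same way with $\widehat\sigma_n$ in place of $\sigma_n$. For a finite word $u$, $|u|$ is its length and $|u|_a$ the number of occurrences of the letter $a$ in $u$. A sequence $\nu\in\{0,1\}^{\mathbb{N}}$ is $C$-balanced ($C>0$) if for all finite factors (contiguous subwords) $u,v$ of $\nu$ with $|u|=|v|$ one has $-C\le|u|_a-|v|_a\le C$ for every letter $a$. -}

module Defs where

open import Data.Empty using (⊥; ⊥-elim)
open import Data.Fin.Base using (Fin)
open import Data.Fin.Patterns using (0F; 1F)
open import Data.Fin.Properties using (_≟_)
open import Data.Integer.Base as ℤ using (+_)
import Data.Integer.Properties as ℤ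
open import Data.List.Base using (List; []; _∷_; length; filter; replicate; applyUpTo)
open import Data.List.NonEmpty.Base as List⁺ using (List⁺; _∷_; _++⁺_; [_])
open import Data.Nat.Base as ℕ using (ℕ; zero; suc; NonZero)
import Data.Nat.Properties as ℕ
open import Data.Nat.GeneralisedArithmetic using (fold)
open import Data.Product using (Σ; ∃; ∃!; ∃-syntax; Σ-syntax; _×_; _,_; proj₁; proj₂)
open import Data.Rational.Base as ℚ using (ℚ; 0ℚ; 1ℚ; mkℚ; positive)
import Data.Rational.Properties as ℚ
open import Data.Rational.Solver using (module +-*-Solver)
open import Data.Sum.Base using (_⊎_; inj₁; inj₂)
open import Function.Base using (_∘_)
open import Relation.Binary.Definitions using (tri<; tri≈; tri>)
open import Relation.Binary.PropositionalEquality
  using (_≡_; refl; sym; trans; cong; subst; subst₂; _≗_)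
open import Relation.Nullary using (¬_; yes; no)

ℕ→ℚ : ℕ → ℚ
ℕ→ℚ n = + n ℚ./ 1

[q-d]+d≡q : ∀ q d → (q ℚ.- d) ℚ.+ d ≡ q
[q-d]+d≡q = solve 2 (λ q d → ((q :- d) :+ d) := q) refl
  where open +-*-Solver

[q+d]-d≡q : ∀ q d → (q ℚ.+ d) ℚ.- d ≡ q
[q+d]-d≡q = solve 2 (λ q d → ((q :+ d) :- d) := q) refl
  where open +-*-Solver

ℕ→ℚ-positive : ∀ n .{{_ : NonZero n}} → 0ℚ ℚ.< ℕ→ℚ n
ℕ→ℚ-positive n = ℚ.positive⁻¹ (ℕ→ℚ n) {{ℚ.normalize-pos n 1}}

ℕ→ℚ-suc : ∀ n → ℕ→ℚ (suc n) ≡ 1ℚ ℚ.+ ℕ→ℚ n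
ℕ→ℚ-suc n = ℚ.toℚᵘ-injective (ℚᵘ.≃-trans (eq (suc n)) (ℚᵘ.≃-sym
    (ℚᵘ.≃-trans (ℚ.toℚᵘ-homo-+ 1ℚ (ℕ→ℚ n))
    (ℚᵘ.≃-trans (ℚᵘ.+-congʳ ℚᵘ.1ℚᵘ (eq n)) (ℚᵘ.*≡* lemma)))))
  where
  import Data.Rational.Unnormalised as ℚᵘ
  import Data.Rational.Unnormalised.Properties as ℚᵘ
  open import Data.Integer.Solver renaming (module +-*-Solver to S)
  eq : ∀ m → ℚ.toℚᵘ (ℕ→ℚ m) ℚᵘ.≃ ℚᵘ.mkℚᵘ (+ m) 0
  eq m = ℚ.toℚᵘ-fromℚᵘ (ℚᵘ.mkℚᵘ (+ m) 0)
  lemma : (+ 1 ℤ.* + 1 ℤ.+ + n ℤ.* + 1) ℤ.* + 1 ≡ + suc n ℤ.* + 1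
  lemma = S.solve 1 (λ m → (S.con (+ 1) S.:* S.con (+ 1) S.:+ m S.:* S.con (+ 1)) S.:* S.con (+ 1)
                     S.:= (S.con (+ 1) S.:+ m) S.:* S.con (+ 1)) refl (+ n)

ℕ→ℚ-bound : ∀ q → ∃[ n ] q ℚ.≤ ℕ→ℚ n
ℕ→ℚ-bound q@(mkℚ i d-1 _) = ℤ.∣ i ∣ , ℚ.toℚᵘ-cancel-≤
    (ℚᵘ.≤-respʳ-≃ (ℚᵘ.≃-sym (ℚ.toℚᵘ-fromℚᵘ (ℚᵘ.mkℚᵘ (+ ℤ.∣ i ∣) 0)))
      (ℚᵘ.*≤* (ℤ.≤-trans (ℤ.≤-reflexive (ℤ.*-identityʳ i)) (lemma i))))
  where
  import Data.Rational.Unnormalised as ℚᵘ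
  import Data.Rational.Unnormalised.Properties as ℚᵘ
  lemma : ∀ i → i ℤ.≤ + ℤ.∣ i ∣ ℤ.* + suc d-1
  lemma (+ n) = subst (+ n ℤ.≤_) (ℤ.pos-* n (suc d-1)) (ℤ.+≤+ (ℕ.m≤m*n n (suc d-1)))
  lemma (ℤ.-[1+ n ]) = subst (ℤ.-[1+ n ] ℤ.≤_) (ℤ.pos-* (suc n) (suc d-1)) ℤ.-≤+

quotient : ∀ m r → 0ℚ ℚ.< r → ∃[ q ] q ℚ.* r ≡ m
quotient m r 0<r = m ℚ.* (ℚ.1/ r) ,
    trans (ℚ.*-assoc m (ℚ.1/ r) r) (trans (cong (m ℚ.*_) (ℚ.*-inverseˡ r)) (ℚ.*-identityʳ m))
  where instance r≢0 = ℚ.>-nonZero 0<r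

*-mono-< : ∀ {r p q} → 0ℚ ℚ.< r → p ℚ.< q → p ℚ.* r ℚ.< q ℚ.* r
*-mono-< {r} 0<r = ℚ.*-monoˡ-<-pos r {{positive 0<r}}

*-cancel-< : ∀ {r p q} → 0ℚ ℚ.< r → p ℚ.* r ℚ.< q ℚ.* r → p ℚ.< q
*-cancel-< {r} 0<r = ℚ.*-cancelʳ-<-nonNeg r {{ℚ.pos⇒nonNeg r {{positive 0<r}}}}

-- Two-sided Dedekind cuts: `lower q` reads q < x, and `upper q` reads x < q.
record ℝ : Set₁ where
  field
    lower upper     : ℚ → Set
    lower-inhabited : ∃ lower
    upper-inhabited : ∃ upper
    lower-closed    : ∀ {p q} → p ℚ.< q → lower q → lower p
    upper-closed    : ∀ {p q} → p ℚ.< q → upper p → upper q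
    lower-open      : ∀ {q} → lower q → ∃[ r ] q ℚ.< r × lower r
    upper-open      : ∀ {q} → upper q → ∃[ r ] r ℚ.< q × upper r
    disjoint        : ∀ {q} → lower q → upper q → ⊥
    located         : ∀ {p q} → p ℚ.< q → lower p ⊎ upper q

open ℝ

fromℚ : ℚ → ℝ
fromℚ a = record
  { lower           = ℚ._< a
  ; upper           = a ℚ.<_
  ; lower-inhabited = a ℚ.- 1ℚ , subst (a ℚ.- 1ℚ ℚ.<_) (ℚ.+-identityʳ a) (ℚ.+-monoʳ-< a (ℚ.negative⁻¹ (ℚ.- 1ℚ)))
  ; upper-inhabited = a ℚ.+ 1ℚ , subst (ℚ._< a ℚ.+ 1ℚ) (ℚ.+-identityʳ a) (ℚ.+-monoʳ-< a (ℚ.positive⁻¹ 1ℚ))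
  ; lower-closed    = ℚ.<-trans
  ; upper-closed    = λ p<q a<p → ℚ.<-trans a<p p<q
  ; lower-open      = ℚ.<-dense
  ; upper-open      = λ a<q → let r , a<r , r<q = ℚ.<-dense a<q in r , r<q , a<r
  ; disjoint        = ℚ.<-asym
  ; located         = loc
  }
  where
  loc : ∀ {p q} → p ℚ.< q → p ℚ.< a ⊎ a ℚ.< q
  loc {p} p<q with p ℚ.<? a
  ... | yes p<a = inj₁ p<a
  ... | no  p≮a = inj₂ (ℚ.≤-<-trans (ℚ.≮⇒≥ p≮a) p<q)

infix 4 _≤ᴿ_ _<ᴿ_ _≃ᴿ_ _#ᴿ_

_≤ᴿ_ _<ᴿ_ _≃ᴿ_ _#ᴿ_ : ℝ → ℝ → Set
x ≤ᴿ y = ∀ q → lower x q → lower y q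
x <ᴿ y = ∃[ q ] upper x q × lower y q
x ≃ᴿ y = x ≤ᴿ y × y ≤ᴿ x
x #ᴿ y = x <ᴿ y ⊎ y <ᴿ x

-- Classically the same as not being equal to any rational; apartness is what
-- makes ⌊N/x⌋ computable.
Irrational : ℝ → Set
Irrational x = ∀ q → x #ᴿ fromℚ q

upper⇒< : ∀ x {q} → upper x q → x <ᴿ fromℚ q
upper⇒< x u = let r , r<q , ur = upper-open x u in r , ur , r<q

lower⇒> : ∀ x {q} → lower x q → fromℚ q <ᴿ x
lower⇒> x l = lower-open x l

<⇒upper : ∀ x {q} → x <ᴿ fromℚ q → upper x q
<⇒upper x (r , ur , r<q) = upper-closed x r<q ur

>⇒lower : ∀ x {q} → fromℚ q <ᴿ x → lower x q
>⇒lower x (r , q<r , lr) = lower-closed x q<r lr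

lower⇒≥ : ∀ x {q} → lower x q → fromℚ q ≤ᴿ x
lower⇒≥ x l r r<q = lower-closed x r<q l

≥⇒¬upper : ∀ x {q} → fromℚ q ≤ᴿ x → upper x q → ⊥
≥⇒¬upper x q≤x u = let r , r<q , ur = upper-open x u in disjoint x (q≤x r r<q) ur

compare : ∀ {x} → Irrational x → ∀ q → lower x q ⊎ upper x q
compare {x} irr q with irr q
... | inj₁ x<q = inj₂ (<⇒upper x x<q)
... | inj₂ q<x = inj₁ (>⇒lower x q<x)

compare⇒irrational : ∀ x → (∀ q → lower x q ⊎ upper x q) → Irrational x
compare⇒irrational x cmp q with cmp q
... | inj₁ l = inj₂ (lower⇒> x l)
... | inj₂ u = inj₁ (upper⇒< x u)

lower<upper : ∀ x {p q} → lower x p → upper x q → p ℚ.< q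
lower<upper x {p} {q} l u with ℚ.<-cmp p q
... | tri< p<q _ _ = p<q
... | tri≈ _ refl _ = ⊥-elim (disjoint x l u)
... | tri> _ _ q<p = ⊥-elim (disjoint x (lower-closed x q<p l) u)

infixl 6 _-ᴿ_

_-ᴿ_ : ℝ → ℚ → ℝ
x -ᴿ d = record
  { lower           = λ q → lower x (q ℚ.+ d)
  ; upper           = λ q → upper x (q ℚ.+ d)
  ; lower-inhabited = let q , l = lower-inhabited x in q ℚ.- d , shift (lower x) l
  ; upper-inhabited = let q , u = upper-inhabited x in q ℚ.- d , shift (upper x) u
  ; lower-closed    = λ p<q → lower-closed x (ℚ.+-monoˡ-< d p<q)
  ; upper-closed    = λ p<q → upper-closed x (ℚ.+-monoˡ-< d p<q)
  ; lower-open      = λ {q} l → let r , q+d<r , lr = lower-open x l in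
                        r ℚ.- d
                        , subst (ℚ._< r ℚ.- d) ([q+d]-d≡q q d) (ℚ.+-monoˡ-< (ℚ.- d) q+d<r)
                        , shift (lower x) lr
  ; upper-open      = λ {q} u → let r , r<q+d , ur = upper-open x u in
                        r ℚ.- d
                        , subst (r ℚ.- d ℚ.<_) ([q+d]-d≡q q d) (ℚ.+-monoˡ-< (ℚ.- d) r<q+d)
                        , shift (upper x) ur
  ; disjoint        = disjoint x
  ; located         = λ p<q → located x (ℚ.+-monoˡ-< d p<q)
  }
  where
  shift : ∀ (P : ℚ → Set) {q} → P q → P ((q ℚ.- d) ℚ.+ d)
  shift P {q} = subst P (sym ([q-d]+d≡q q d))

-ᴿ-irrational : ∀ y d → Irrational y → Irrational (y -ᴿ d)
-ᴿ-irrational y d irr = compare⇒irrational (y -ᴿ d) (λ q → compare {y} irr (q ℚ.+ d))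

0≤fraction : ∀ y n → fromℚ (ℕ→ℚ n) ≤ᴿ y → fromℚ 0ℚ ≤ᴿ y -ᴿ ℕ→ℚ n
0≤fraction y n n≤y q q<0 = n≤y (q ℚ.+ ℕ→ℚ n)
  (subst (q ℚ.+ ℕ→ℚ n ℚ.<_) (ℚ.+-identityˡ (ℕ→ℚ n)) (ℚ.+-monoˡ-< (ℕ→ℚ n) q<0))

fraction≤1 : ∀ y n → y <ᴿ fromℚ (ℕ→ℚ (suc n)) → y -ᴿ ℕ→ℚ n ≤ᴿ fromℚ 1ℚ
fraction≤1 y n y<1+n q l = subst₂ ℚ._<_
  ([q+d]-d≡q q (ℕ→ℚ n)) (trans (cong (ℚ._- ℕ→ℚ n) (ℕ→ℚ-suc n)) ([q+d]-d≡q 1ℚ (ℕ→ℚ n)))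
  (ℚ.+-monoˡ-< (ℚ.- ℕ→ℚ n) (lower<upper y l (<⇒upper y y<1+n)))

-- N/x for x > 0, whose cut is described without division:
--   q < N/x  iff  q r < N for some rational r > x,
--   N/x < q  iff  N < q r for some rational r with 0 < r < x.
module Reciprocal (N : ℕ) .{{_ : NonZero N}} (x : ℝ) (0<x : fromℚ 0ℚ <ᴿ x) where

  n = ℕ→ℚ N

  0<n : 0ℚ ℚ.< n
  0<n = ℕ→ℚ-positive N

  pos : ∀ {r} → upper x r → 0ℚ ℚ.< r
  pos = lower<upper x (>⇒lower x 0<x)

  Low Upp : ℚ → Set
  Low q = ∃[ r ] upper x r × q ℚ.* r ℚ.< n
  Upp q = ∃[ r ] 0ℚ ℚ.< r × lower x r × n ℚ.< q ℚ.* r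

  -- A rational q ≤ 0 lies below N/x.
  low-nonpos : ∀ {q} → q ℚ.≤ 0ℚ → Low q
  low-nonpos {q} q≤0 = let r , u = upper-inhabited x in r , u ,
    ℚ.≤-<-trans (subst (q ℚ.* r ℚ.≤_) (ℚ.*-zeroˡ r)
      (ℚ.*-monoʳ-≤-nonNeg r {{ℚ.pos⇒nonNeg r {{positive (pos u)}}}} q≤0)) 0<n

  low : ∀ {q s} → 0ℚ ℚ.< q → s ℚ.* q ≡ n → upper x s → Low q
  low {q} {s} 0<q sq≡n u = let r , r<s , ur = upper-open x u in r , ur ,
    subst₂ ℚ._<_ (ℚ.*-comm r q) sq≡n (*-mono-< 0<q r<s)

  upp : ∀ {q s} → 0ℚ ℚ.< q → s ℚ.* q ≡ n → lower x s → Upp q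
  upp {q} {s} 0<q sq≡n l = let r , s<r , lr = lower-open x l in r ,
    ℚ.<-trans (*-cancel-< 0<q (subst₂ ℚ._<_ (sym (ℚ.*-zeroˡ q)) (sym sq≡n) 0<n)) s<r ,
    lr , subst₂ ℚ._<_ sq≡n (ℚ.*-comm r q) (*-mono-< 0<q s<r)

  low-open : ∀ {q} → Low q → ∃[ q′ ] q ℚ.< q′ × Low q′
  low-open {q} (r , u , qr<n) =
    let m , qr<m , m<n = ℚ.<-dense qr<n
        q′ , q′r≡m     = quotient m r (pos u)
    in q′ , *-cancel-< (pos u) (subst (q ℚ.* r ℚ.<_) (sym q′r≡m) qr<m)
          , r , u , subst (ℚ._< n) (sym q′r≡m) m<n

  upp-open : ∀ {q} → Upp q → ∃[ q′ ] q′ ℚ.< q × Upp q′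
  upp-open {q} (r , 0<r , l , n<qr) =
    let m , n<m , m<qr = ℚ.<-dense n<qr
        q′ , q′r≡m     = quotient m r 0<r
    in q′ , *-cancel-< 0<r (subst (ℚ._< q ℚ.* r) (sym q′r≡m) m<qr)
          , r , 0<r , l , subst (n ℚ.<_) (sym q′r≡m) n<m

  low-upp : ∀ {q} → Low q → Upp q → ⊥
  low-upp {q} (r , u , qr<n) (s , 0<s , l , n<qs) =
      ℚ.<-asym (ℚ.<-trans qr<n n<qs)
        (subst₂ ℚ._<_ (ℚ.*-comm s q) (ℚ.*-comm r q) (*-mono-< 0<q (lower<upper x l u)))
    where
    0<q : 0ℚ ℚ.< q
    0<q = *-cancel-< 0<s (subst (ℚ._< q ℚ.* s) (sym (ℚ.*-zeroˡ s)) (ℚ.<-trans 0<n n<qs))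

  low-upp-located : ∀ {p q} → p ℚ.< q → Low p ⊎ Upp q
  low-upp-located {p} {q} p<q with 0ℚ ℚ.<? p
  ... | no  0≮p = inj₁ (low-nonpos (ℚ.≮⇒≥ 0≮p))
  ... | yes 0<p = go (quotient n p 0<p) (quotient n q 0<q)
    where
    0<q : 0ℚ ℚ.< q
    0<q = ℚ.<-trans 0<p p<q
    go : ∃[ s ] s ℚ.* p ≡ n → ∃[ t ] t ℚ.* q ≡ n → Low p ⊎ Upp q
    go (s , sp≡n) (t , tq≡n) with located x t<s
      where
      0<t : 0ℚ ℚ.< t
      0<t = *-cancel-< 0<q (subst₂ ℚ._<_ (sym (ℚ.*-zeroˡ q)) (sym tq≡n) 0<n)
      t<s : t ℚ.< s
      t<s = *-cancel-< 0<p (subst₂ ℚ._<_ (ℚ.*-comm p t) (trans (trans (ℚ.*-comm q t) tq≡n) (sym sp≡n))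
              (*-mono-< 0<t p<q))
    ... | inj₁ l = inj₂ (upp 0<q tq≡n l)
    ... | inj₂ u = inj₁ (low 0<p sp≡n u)

  N/x : ℝ
  N/x = record
    { lower           = Low
    ; upper           = Upp
    ; lower-inhabited = 0ℚ , low-nonpos ℚ.≤-refl
    ; upper-inhabited = let s , 0<s , l = 0<x
                            q , qs≡n+1  = quotient (n ℚ.+ 1ℚ) s 0<s
                        in q , s , 0<s , l
                             , subst₂ ℚ._<_ (ℚ.+-identityʳ n) (sym qs≡n+1) (ℚ.+-monoʳ-< n (ℚ.positive⁻¹ 1ℚ))
    ; lower-closed    = λ { p<q (r , u , qr<n) → r , u , ℚ.<-trans (*-mono-< (pos u) p<q) qr<n }
    ; upper-closed    = λ { p<q (r , 0<r , l , n<pr) → r , 0<r , l , ℚ.<-trans n<pr (*-mono-< 0<r p<q) }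
    ; lower-open      = low-open
    ; upper-open      = upp-open
    ; disjoint        = λ {q} → low-upp {q}
    ; located         = low-upp-located
    }

  N/x-positive : fromℚ 0ℚ <ᴿ N/x
  N/x-positive = lower⇒> N/x (low-nonpos ℚ.≤-refl)

  N/x-irrational : Irrational x → Irrational N/x
  N/x-irrational irr = compare⇒irrational N/x cmp
    where
    cmp : ∀ q → Low q ⊎ Upp q
    cmp q with 0ℚ ℚ.<? q
    ... | no  0≮q = inj₁ (low-nonpos (ℚ.≮⇒≥ 0≮q))
    ... | yes 0<q with quotient n q 0<q
    ...   | s , sq≡n with compare {x} irr s
    ...     | inj₁ l = inj₂ (upp 0<q sq≡n l)
    ...     | inj₂ u = inj₁ (low 0<q sq≡n u)

open Reciprocal public using (N/x; N/x-positive; N/x-irrational)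

floor : ∀ y → Irrational y → fromℚ 0ℚ <ᴿ y →
        Σ[ d ∈ ℕ ] fromℚ (ℕ→ℚ d) ≤ᴿ y × y <ᴿ fromℚ (ℕ→ℚ (suc d))
floor y irr 0<y =
    let q , uq       = upper-inhabited y
        k , q≤k      = ℕ→ℚ-bound q
        r , r<q , ur = upper-open y uq
    in search k (upper-closed y (ℚ.<-≤-trans r<q q≤k) ur)
  where
  search : ∀ k → upper y (ℕ→ℚ k) → Σ[ d ∈ ℕ ] fromℚ (ℕ→ℚ d) ≤ᴿ y × y <ᴿ fromℚ (ℕ→ℚ (suc d))
  search zero    u = ⊥-elim (disjoint y (>⇒lower y 0<y) u)
  search (suc k) u with compare {y} irr (ℕ→ℚ k)
  ... | inj₁ l  = k , lower⇒≥ y l , upper⇒< y u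
  ... | inj₂ u′ = search k u′

-- [0,1] ∖ ℚ
record 𝕀 : Set₁ where
  field
    value      : ℝ
    irrational : Irrational value
    0≤value    : fromℚ 0ℚ ≤ᴿ value
    value≤1    : value ≤ᴿ fromℚ 1ℚ

  0<value : fromℚ 0ℚ <ᴿ value
  0<value with irrational 0ℚ
  ... | inj₁ x<0 = ⊥-elim (≥⇒¬upper value 0≤value (<⇒upper value x<0))
  ... | inj₂ 0<x = 0<x

module _ (N : ℕ) .{{_ : NonZero N}} where

  quot : 𝕀 → ℝ
  quot x = N/x N value 0<value
    where open 𝕀 x

  quot-irrational : ∀ x → Irrational (quot x)
  quot-irrational x = N/x-irrational N value 0<value irrational
    where open 𝕀 x

  quot-floor : ∀ x → Σ[ d ∈ ℕ ] fromℚ (ℕ→ℚ d) ≤ᴿ quot x × quot x <ᴿ fromℚ (ℕ→ℚ (suc d))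
  quot-floor x = floor (quot x) (quot-irrational x) (N/x-positive N value 0<value)
    where open 𝕀 x

  ⌊N/_⌋ : 𝕀 → ℕ
  ⌊N/ x ⌋ = proj₁ (quot-floor x)

  -- The map T_N, restricted to the irrationals, which it preserves; its value
  -- at 0 therefore plays no role.
  T : 𝕀 → 𝕀
  T x = record
    { value      = quot x -ᴿ ℕ→ℚ ⌊N/ x ⌋
    ; irrational = -ᴿ-irrational (quot x) (ℕ→ℚ ⌊N/ x ⌋) (quot-irrational x)
    ; 0≤value    = 0≤fraction (quot x) ⌊N/ x ⌋ (proj₁ (proj₂ (quot-floor x)))
    ; value≤1    = fraction≤1 (quot x) ⌊N/ x ⌋ (proj₂ (proj₂ (quot-floor x)))
    }

  -- Indexed from 0: digit x n is d_{n+1} in the usual numbering; likewise for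
  -- the substitutions and words below.
  digit : 𝕀 → ℕ → ℕ
  digit x n = ⌊N/ fold x T n ⌋

Letter : Set
Letter = Fin 2

Word : Set
Word = ℕ → Letter

Substitution : Set
Substitution = Letter → List⁺ Letter

-- prepend u w is the infinite concatenation u · w 0 · w 1 · w 2 ⋯
prepend : List⁺ Letter → (ℕ → List⁺ Letter) → Word
prepend (a ∷ u)     w zero    = a
prepend (a ∷ [])    w (suc i) = prepend (w 0) (w ∘ suc) i
prepend (a ∷ b ∷ u) w (suc i) = prepend (b ∷ u) w i

concat : (ℕ → List⁺ Letter) → Word
concat w = prepend (w 0) (w ∘ suc)

_⟪_⟫ : Substitution → Word → Word
σ ⟪ ω ⟫ = concat (σ ∘ ω)

-- Equality of words is pointwise, as function extensionality is unavailable.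
Desubstitutes : (ℕ → Substitution) → Word → Set
Desubstitutes σ ω = Σ[ ω′ ∈ (ℕ → Word) ] ω′ 0 ≗ ω × (∀ n → ω′ n ≗ σ n ⟪ ω′ (suc n) ⟫)

module _ (N : ℕ) .{{_ : NonZero N}} where

  _^N : Letter → List⁺ Letter
  a ^N = List⁺.replicate N (ℕ.≢-nonZero⁻¹ N) a

  σ σ̂ : ℕ → Substitution
  σ d 0F = replicate d 0F ++⁺ (1F ^N)
  σ d 1F = [ 0F ]
  σ̂ d 0F = replicate d 0F ++⁺ [ 1F ]
  σ̂ d 1F = 0F ^N

  IsNCFSequence IsDualNCFSequence : 𝕀 → Word → Set
  IsNCFSequence     x = Desubstitutes (λ n → σ (digit N x n))
  IsDualNCFSequence x = Desubstitutes (λ n → σ̂ (digit N x n))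

-- Q holds of "the unique word ω satisfying P". Existence and uniqueness are part
-- of the claim, so that it cannot hold vacuously.
TheWord : (P Q : Word → Set) → Set
TheWord P Q = ∃! _≗_ P × (∀ ω → P ω → Q ω)

∣_∣₍_₎ : List Letter → Letter → ℕ
∣ u ∣₍ a ₎ = length (filter (a ≟_) u)

IsFactor : Word → List Letter → Set
IsFactor ν u = ∃[ k ] u ≡ applyUpTo (λ i → ν (k ℕ.+ i)) (length u)

Balanced : ℕ → Word → Set
Balanced C ν = ∀ u v → IsFactor ν u → IsFactor ν v → length u ≡ length v → ∀ a →
  ℤ.- (+ C) ℤ.≤ + ∣ u ∣₍ a ₎ ℤ.- + ∣ v ∣₍ a ₎ × + ∣ u ∣₍ a ₎ ℤ.- + ∣ v ∣₍ a ₎ ℤ.≤ + C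

-- No sequence of irrationals exhausts the x satisfying P, stated positively: a
-- missed x is produced. Classically this says that { x | P x } is not countable.
UncountablyMany : (𝕀 → Set) → Set₁
UncountablyMany P = ∀ (f : ℕ → 𝕀) →
  Σ[ x ∈ 𝕀 ] P x × (∀ n → ¬ (𝕀.value x ≃ᴿ 𝕀.value (f n)))

{-# OPTIONS --safe #-}

-- Both substitutions have the form 0 ↦ 0^d 1^p, 1 ↦ 0^q with p q = N. Let Z and O
-- count the 0s and 1s of a prefix of the image of ω, and z, o those of the
-- corresponding prefix of ω; then O is p z up to rounding, and Z = d z + q o + r
-- with 0 ≤ r ≤ d. If two factors differ by more than C p in O and by more than C,
-- in the opposite direction, in Z, then they come from factors one level up with
-- the same property and the letters exchanged, provided that
-- C p q < d (C - 1) + C + 1. Positions shrink, so such factors do not exist and the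
-- word is C p-balanced. The condition holds for C = N when d ≥ N and for C = 2 when
-- d ≥ 2 N. The rest is a diagonal argument over digit sequences in {2N, 2N + 1},
-- each of which is realised by an irrational: comparing a rational with
-- N / (a₀ + N / (a₁ + ⋯)) is Euclid's algorithm.

module Submission where

open import Defs
open import Data.Empty using (⊥; ⊥-elim)
open import Data.Fin.Patterns using (0F; 1F)
import Data.Fin.Properties as Fin
open import Data.Integer.Base as ℤ using (0ℤ)
import Data.Integer.Properties as ℤ
open import Data.List.Base using (List; []; _∷_; _++_; length; filter; replicate; applyUpTo)
open import Data.List.NonEmpty.Base as List⁺ using (List⁺; _∷_)
open import Data.List.Properties
open import Data.List.Relation.Unary.All.Properties using (replicate⁺)
open import Data.Nat.Base hiding (compare)
open import Data.Nat.GeneralisedArithmetic using (fold)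
open import Data.Nat.Induction using (<-rec)
open import Data.Nat.Properties hiding (*-cancel-<; *-mono-<)
open import Data.Nat.Tactic.RingSolver using (solve-∀)
open import Data.Product using (∃!)
open import Data.Product.Base using (∃-syntax; Σ-syntax; _×_; _,_; proj₁; proj₂)
open import Data.Rational.Base as ℚ using (ℚ; 0ℚ; 1ℚ)
import Data.Rational.Properties as ℚ
open import Data.Rational.Unnormalised.Base as ℚᵘ using (mkℚᵘ)
import Data.Rational.Unnormalised.Properties as ℚᵘ
open import Data.Sum.Base using (_⊎_; inj₁; inj₂; [_,_]′; map₂)
open import Function.Base using (_∘_)
open import Relation.Binary.PropositionalEquality
open import Relation.Nullary using (¬_; yes; no)

-- Finite prefixes of infinite words and locality of substitutions

infixr 5 _▹_

_▹_ : List Letter → Word → Word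
([]      ▹ ω) i       = ω i
((a ∷ u) ▹ ω) zero    = a
((a ∷ u) ▹ ω) (suc i) = (u ▹ ω) i

▹-++ : ∀ u v ω → (u ++ v) ▹ ω ≗ u ▹ v ▹ ω
▹-++ []      v ω i       = refl
▹-++ (a ∷ u) v ω zero    = refl
▹-++ (a ∷ u) v ω (suc i) = ▹-++ u v ω i

prepend≗▹ : ∀ u w → prepend u w ≗ List⁺.toList u ▹ concat w
prepend≗▹ (a ∷ u)     w zero    = refl
prepend≗▹ (a ∷ [])    w (suc i) = refl
prepend≗▹ (a ∷ b ∷ u) w (suc i) = prepend≗▹ (b ∷ u) w i

image : Substitution → Letter → List Letter
image τ a = List⁺.toList (τ a)

unfold : ∀ τ ω → τ ⟪ ω ⟫ ≗ image τ (ω 0) ▹ τ ⟪ ω ∘ suc ⟫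
unfold τ ω = prepend≗▹ (τ (ω 0)) (τ ∘ ω ∘ suc)

infix 4 _≈[_]_

_≈[_]_ : Word → ℕ → Word → Set
ω ≈[ m ] ω′ = ∀ {i} → i < m → ω i ≡ ω′ i

▹-agree : ∀ u {m ω ω′} → ω ≈[ m ] ω′ → u ▹ ω ≈[ length u + m ] u ▹ ω′
▹-agree []      agree i<m               = agree i<m
▹-agree (a ∷ u) agree {zero}  _         = refl
▹-agree (a ∷ u) agree {suc i} (s≤s i<m) = ▹-agree u agree i<m

⟪⟫-agree-head : ∀ τ {m ω ω′ a} → ω 0 ≡ a → ω′ 0 ≡ a →
  τ ⟪ ω ∘ suc ⟫ ≈[ m ] τ ⟪ ω′ ∘ suc ⟫ → τ ⟪ ω ⟫ ≈[ length (image τ a) + m ] τ ⟪ ω′ ⟫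
⟪⟫-agree-head τ {m} {ω} {ω′} refl eq agree {i} i<m = begin
  (τ ⟪ ω ⟫) i                                 ≡⟨ unfold τ ω i ⟩
  (image τ (ω 0) ▹ τ ⟪ ω ∘ suc ⟫) i           ≡⟨ ▹-agree (image τ (ω 0)) agree i<m ⟩
  (image τ (ω 0) ▹ τ ⟪ ω′ ∘ suc ⟫) i          ≡⟨ cong (λ a → (image τ a ▹ τ ⟪ ω′ ∘ suc ⟫) i) eq ⟨
  (image τ (ω′ 0) ▹ τ ⟪ ω′ ∘ suc ⟫) i         ≡⟨ unfold τ ω′ i ⟨
  (τ ⟪ ω′ ⟫) i                                ∎
  where open ≡-Reasoning

-- Images of letters are nonempty, so each common letter of the arguments contributes at least one
-- common letter of the images.
⟪⟫-agree : ∀ τ m {ω ω′} → ω ≈[ m ] ω′ → τ ⟪ ω ⟫ ≈[ m ] τ ⟪ ω′ ⟫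
⟪⟫-agree τ (suc m) {ω} {ω′} agree i<m = ⟪⟫-agree-head τ {ω = ω} {ω′} refl (sym (agree (s≤s z≤n)))
  (⟪⟫-agree τ m (λ i<m → agree (s≤s i<m))) (<-≤-trans i<m (s≤s (m≤n+m m _)))

-- Counting letters in prefixes

count : Word → Letter → ℕ → ℕ
count ω a i = ∣ applyUpTo ω i ∣₍ a ₎

applyUpTo-cong : ∀ {ω ω′ : Word} → ω ≗ ω′ → ∀ i → applyUpTo ω i ≡ applyUpTo ω′ i
applyUpTo-cong ω≗ω′ zero    = refl
applyUpTo-cong ω≗ω′ (suc i) = cong₂ _∷_ (ω≗ω′ 0) (applyUpTo-cong (ω≗ω′ ∘ suc) i)

applyUpTo-+ : ∀ (ω : Word) m n → applyUpTo ω (m + n) ≡ applyUpTo ω m ++ applyUpTo (ω ∘ (m +_)) n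
applyUpTo-+ ω zero    n = refl
applyUpTo-+ ω (suc m) n = cong (ω 0 ∷_) (applyUpTo-+ (ω ∘ suc) m n)

applyUpTo-▹ : ∀ u ω i → applyUpTo (u ▹ ω) (length u + i) ≡ u ++ applyUpTo ω i
applyUpTo-▹ []      ω i = refl
applyUpTo-▹ (a ∷ u) ω i = cong (a ∷_) (applyUpTo-▹ u ω i)

applyUpTo-replicate : ∀ {a i m} ω → i ≤ m → applyUpTo (replicate m a ▹ ω) i ≡ replicate i a
applyUpTo-replicate ω z≤n       = refl
applyUpTo-replicate ω (s≤s i≤m) = cong (_ ∷_) (applyUpTo-replicate ω i≤m)

∣++∣ : ∀ a u v → ∣ u ++ v ∣₍ a ₎ ≡ ∣ u ∣₍ a ₎ + ∣ v ∣₍ a ₎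
∣++∣ a u v = trans (cong length (filter-++ (a Fin.≟_) u v)) (length-++ (filter (a Fin.≟_) u))

∣replicate∣-same : ∀ a n → ∣ replicate n a ∣₍ a ₎ ≡ n
∣replicate∣-same a n =
  trans (cong length (filter-all (a Fin.≟_) (replicate⁺ n refl))) (length-replicate n)

∣replicate∣-other : ∀ {a b} → a ≢ b → ∀ n → ∣ replicate n b ∣₍ a ₎ ≡ 0
∣replicate∣-other {a} a≢b n = cong length (filter-none (a Fin.≟_) (replicate⁺ n a≢b))

∣∣-total : ∀ u → ∣ u ∣₍ 0F ₎ + ∣ u ∣₍ 1F ₎ ≡ length u
∣∣-total []       = refl
∣∣-total (0F ∷ u) = cong suc (∣∣-total u)
∣∣-total (1F ∷ u) = trans (+-suc ∣ u ∣₍ 0F ₎ ∣ u ∣₍ 1F ₎) (cong suc (∣∣-total u))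

count-head : ∀ (ω : Word) {b} → ω 0 ≡ b → ∀ a k →
  count ω a (suc k) ≡ ∣ b ∷ [] ∣₍ a ₎ + count (ω ∘ suc) a k
count-head ω refl a k = ∣++∣ a (ω 0 ∷ []) (applyUpTo (ω ∘ suc) k)

-- Prefix counts in the image of a block substitution

record IsBlock (d p q : ℕ) (τ : Substitution) : Set where
  field
    image-0 : image τ 0F ≡ replicate d 0F ++ replicate p 1F
    image-1 : image τ 1F ≡ replicate q 0F

0≢1 : _≢_ {A = Letter} 0F 1F
0≢1 ()

1≢0 : _≢_ {A = Letter} 1F 0F
1≢0 ()

letter : ∀ (a : Letter) → a ≡ 0F ⊎ a ≡ 1F
letter 0F = inj₁ refl
letter 1F = inj₂ refl

module Rounding {d p q : ℕ} .{{_ : NonZero d}} .{{_ : NonZero p}} .{{_ : NonZero q}}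
  (q≤d : q ≤ d) {τ : Substitution} (block : IsBlock d p q τ) where

  open IsBlock block

  -- The image of the prefix of ω of length k has Z zeros, up to a remainder r
  -- inside one block.
  record Approximates (ω : Word) (i Z k : ℕ) : Set where
    constructor approx
    field
      r     : ℕ
      r≤d   : r ≤ d
      zeros : Z ≡ d * count ω 0F k + q * count ω 1F k + r
      bound : k + count ω 0F k ≤ i

  -- A cut among the 1s of a block can be charged to the blocks before it, with `r` equal to `d`, or
  -- to the blocks up to and including it, with `r` equal to 0. The zeros fit either way, but the
  -- multiple of `p` lies below the number of 1s in the first case and above it in the second.
  Floor Ceiling Rounds : Word → (i Z O : ℕ) → Set
  Floor   ω i Z O = ∃[ k ] Approximates ω i Z k × p * count ω 0F k ≤ O
  Ceiling ω i Z O = ∃[ k ] Approximates ω i Z k × O ≤ p * count ω 0F k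
  Rounds  ω i Z O = Floor ω i Z O × Ceiling ω i Z O

  private variable
    ω : Word
    i : ℕ

  ∣block∣₀ : ∀ s → ∣ replicate d 0F ++ replicate s 1F ∣₍ 0F ₎ ≡ d
  ∣block∣₀ s = begin
    ∣ replicate d 0F ++ replicate s 1F ∣₍ 0F ₎  ≡⟨ ∣++∣ 0F (replicate d 0F) (replicate s 1F) ⟩
    ∣ replicate d 0F ∣₍ 0F ₎ + ∣ replicate s 1F ∣₍ 0F ₎
      ≡⟨ cong₂ _+_ (∣replicate∣-same 0F d) (∣replicate∣-other 0≢1 s) ⟩
    d + 0                                       ≡⟨ +-identityʳ d ⟩
    d                                           ∎
    where open ≡-Reasoning

  ∣block∣₁ : ∀ s → ∣ replicate d 0F ++ replicate s 1F ∣₍ 1F ₎ ≡ s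
  ∣block∣₁ s = begin
    ∣ replicate d 0F ++ replicate s 1F ∣₍ 1F ₎  ≡⟨ ∣++∣ 1F (replicate d 0F) (replicate s 1F) ⟩
    ∣ replicate d 0F ∣₍ 1F ₎ + ∣ replicate s 1F ∣₍ 1F ₎
      ≡⟨ cong₂ _+_ (∣replicate∣-other 1≢0 d) (∣replicate∣-same 1F s) ⟩
    s                                           ∎
    where open ≡-Reasoning

  prefix-zeros : ∀ {m} u → image τ (ω 0) ≡ replicate m 0F ++ u → i ≤ m →
    applyUpTo (τ ⟪ ω ⟫) i ≡ replicate i 0F
  prefix-zeros {ω} {i} {m} u eq i≤m = begin
    applyUpTo (τ ⟪ ω ⟫) i                                        ≡⟨ applyUpTo-cong (unfold τ ω) i ⟩
    applyUpTo (image τ (ω 0) ▹ τ ⟪ ω ∘ suc ⟫) i                  ≡⟨ cong (λ u → applyUpTo (u ▹ _) i) eq ⟩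
    applyUpTo ((replicate m 0F ++ u) ▹ τ ⟪ ω ∘ suc ⟫) i          ≡⟨ applyUpTo-cong (▹-++ (replicate m 0F) u _) i ⟩
    applyUpTo (replicate m 0F ▹ u ▹ τ ⟪ ω ∘ suc ⟫) i             ≡⟨ applyUpTo-replicate _ i≤m ⟩
    replicate i 0F                                               ∎
    where open ≡-Reasoning

  prefix-block : ∀ {s} → ω 0 ≡ 0F → s ≤ p →
    applyUpTo (τ ⟪ ω ⟫) (d + s) ≡ replicate d 0F ++ replicate s 1F
  prefix-block {ω} {s} ω0≡0 s≤p = begin
    applyUpTo (τ ⟪ ω ⟫) (d + s)
      ≡⟨ applyUpTo-cong (unfold τ ω) (d + s) ⟩
    applyUpTo (image τ (ω 0) ▹ τ ⟪ ω ∘ suc ⟫) (d + s)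
      ≡⟨ cong (λ u → applyUpTo (u ▹ _) (d + s)) (trans (cong (image τ) ω0≡0) image-0) ⟩
    applyUpTo ((replicate d 0F ++ replicate p 1F) ▹ τ ⟪ ω ∘ suc ⟫) (d + s)
      ≡⟨ applyUpTo-cong (▹-++ (replicate d 0F) (replicate p 1F) _) (d + s) ⟩
    applyUpTo (replicate d 0F ▹ replicate p 1F ▹ τ ⟪ ω ∘ suc ⟫) (d + s)
      ≡⟨ cong (λ m → applyUpTo (replicate d 0F ▹ replicate p 1F ▹ τ ⟪ ω ∘ suc ⟫) (m + s)) (length-replicate d) ⟨
    applyUpTo (replicate d 0F ▹ replicate p 1F ▹ τ ⟪ ω ∘ suc ⟫) (length (replicate d 0F) + s)
      ≡⟨ applyUpTo-▹ (replicate d 0F) _ s ⟩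
    replicate d 0F ++ applyUpTo (replicate p 1F ▹ τ ⟪ ω ∘ suc ⟫) s
      ≡⟨ cong (replicate d 0F ++_) (applyUpTo-replicate _ s≤p) ⟩
    replicate d 0F ++ replicate s 1F ∎
    where open ≡-Reasoning

  count-beyond : ∀ {u m} → image τ (ω 0) ≡ u → length u ≡ m → ∀ a i →
    count (τ ⟪ ω ⟫) a (m + i) ≡ ∣ u ∣₍ a ₎ + count (τ ⟪ ω ∘ suc ⟫) a i
  count-beyond {ω} refl refl a i = begin
    count (τ ⟪ ω ⟫) a (length (image τ (ω 0)) + i)
      ≡⟨ cong ∣_∣₍ a ₎ (applyUpTo-cong (unfold τ ω) (length (image τ (ω 0)) + i)) ⟩
    count (image τ (ω 0) ▹ τ ⟪ ω ∘ suc ⟫) a (length (image τ (ω 0)) + i)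
      ≡⟨ cong ∣_∣₍ a ₎ (applyUpTo-▹ (image τ (ω 0)) (τ ⟪ ω ∘ suc ⟫) i) ⟩
    ∣ image τ (ω 0) ++ applyUpTo (τ ⟪ ω ∘ suc ⟫) i ∣₍ a ₎
      ≡⟨ ∣++∣ a (image τ (ω 0)) _ ⟩
    ∣ image τ (ω 0) ∣₍ a ₎ + count (τ ⟪ ω ∘ suc ⟫) a i ∎
    where open ≡-Reasoning

  approximates-0 : ∀ {Z} → Z ≤ d → Approximates ω i Z 0
  approximates-0 {Z = Z} Z≤d = approx Z Z≤d
    (cong₂ (λ x y → x + y + Z) (sym (*-zeroʳ d)) (sym (*-zeroʳ q))) z≤n

  -- A leading 0 raises both `k` and the count of 0s by one, so `bound` costs two positions. A
  -- leading 1 raises only `k` and costs one.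
  approximates-zero : ∀ {n Z k} → ω 0 ≡ 0F → 2 + n ≤ i → Approximates (ω ∘ suc) n Z k →
    Approximates ω i (d + Z) (suc k)
  approximates-zero {ω} {n = n} {Z} {k} ω0≡0 2+n≤i (approx r r≤d zeros bound) = approx r r≤d
    (begin
      d + Z                       ≡⟨ cong (d +_) zeros ⟩
      d + (d * z + q * o + r)     ≡⟨ arith d z q o r ⟩
      d * suc z + q * o + r       ≡⟨ cong₂ (λ x y → d * x + q * y + r) count₀ count₁ ⟨
      d * count ω 0F (suc k) + q * count ω 1F (suc k) + r ∎)
    (≤-trans (≤-reflexive (trans (cong (suc k +_) count₀) (cong suc (+-suc k z))))
      (≤-trans (+-monoʳ-≤ 2 bound) 2+n≤i))
    where
    open ≡-Reasoning
    z = count (ω ∘ suc) 0F k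
    o = count (ω ∘ suc) 1F k
    count₀ : count ω 0F (suc k) ≡ suc z
    count₀ = count-head ω ω0≡0 0F k
    count₁ : count ω 1F (suc k) ≡ o
    count₁ = count-head ω ω0≡0 1F k
    arith : ∀ d z q o r → d + (d * z + q * o + r) ≡ d * suc z + q * o + r
    arith = solve-∀

  approximates-one : ∀ {n Z k} → ω 0 ≡ 1F → Approximates (ω ∘ suc) n Z k →
    Approximates ω (q + n) (q + Z) (suc k)
  approximates-one {ω} {n} {Z} {k} ω0≡1 (approx r r≤d zeros bound) = approx r r≤d
    (begin
      q + Z                       ≡⟨ cong (q +_) zeros ⟩
      q + (d * z + q * o + r)     ≡⟨ arith d z q o r ⟩
      d * z + q * suc o + r       ≡⟨ cong₂ (λ x y → d * x + q * y + r) count₀ count₁ ⟨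
      d * count ω 0F (suc k) + q * count ω 1F (suc k) + r ∎)
    (≤-trans (≤-reflexive (cong (suc k +_) count₀)) (+-mono-≤ (>-nonZero⁻¹ q) bound))
    where
    open ≡-Reasoning
    z = count (ω ∘ suc) 0F k
    o = count (ω ∘ suc) 1F k
    count₀ : count ω 0F (suc k) ≡ z
    count₀ = count-head ω ω0≡1 0F k
    count₁ : count ω 1F (suc k) ≡ suc o
    count₁ = count-head ω ω0≡1 1F k
    arith : ∀ d z q o r → q + (d * z + q * o + r) ≡ d * z + q * suc o + r
    arith = solve-∀

  floor-0 : ∀ {Z O} → Z ≤ d → Floor ω i Z O
  floor-0 {O = O} Z≤d = 0 , approximates-0 Z≤d , subst (_≤ O) (sym (*-zeroʳ p)) z≤n

  rounds-0 : ∀ {Z} → Z ≤ d → Rounds ω i Z 0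
  rounds-0 Z≤d = floor-0 Z≤d , 0 , approximates-0 Z≤d , z≤n

  rounds-zero : ∀ {n Z O} → ω 0 ≡ 0F → 2 + n ≤ i → Rounds (ω ∘ suc) n Z O →
    Rounds ω i (d + Z) (p + O)
  rounds-zero {ω} {n = n} {Z} {O} ω0≡0 2+n≤i ((k , app , pz≤O) , (k′ , app′ , O≤pz)) =
      (suc k , approximates-zero ω0≡0 2+n≤i app , subst (_≤ p + O) (eq k) (+-monoʳ-≤ p pz≤O)) ,
      (suc k′ , approximates-zero ω0≡0 2+n≤i app′ , subst (p + O ≤_) (eq k′) (+-monoʳ-≤ p O≤pz))
    where
    eq : ∀ k → p + p * count (ω ∘ suc) 0F k ≡ p * count ω 0F (suc k)
    eq k = trans (sym (*-suc p _)) (cong (p *_) (sym (count-head ω ω0≡0 0F k)))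

  rounds-one : ∀ {n Z O} → ω 0 ≡ 1F → Rounds (ω ∘ suc) n Z O → Rounds ω (q + n) (q + Z) O
  rounds-one {ω} {n} {Z} {O} ω0≡1 ((k , app , pz≤O) , (k′ , app′ , O≤pz)) =
      (suc k , approximates-one ω0≡1 app , subst (_≤ O) (eq k) pz≤O) ,
      (suc k′ , approximates-one ω0≡1 app′ , subst (O ≤_) (eq k′) O≤pz)
    where
    eq : ∀ k → p * count (ω ∘ suc) 0F k ≡ p * count ω 0F (suc k)
    eq k = cong (p *_) (sym (count-head ω ω0≡1 0F k))

  rounds-prefix : ∀ {u Z O} → applyUpTo (τ ⟪ ω ⟫) i ≡ u → ∣ u ∣₍ 0F ₎ ≡ Z → ∣ u ∣₍ 1F ₎ ≡ O →
    Rounds ω i Z O → Rounds ω i (count (τ ⟪ ω ⟫) 0F i) (count (τ ⟪ ω ⟫) 1F i)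
  rounds-prefix {ω} {i} eq refl refl =
    subst (λ u → Rounds ω i ∣ u ∣₍ 0F ₎ ∣ u ∣₍ 1F ₎) (sym eq)

  RoundsAt : ℕ → Set
  RoundsAt i = ∀ ω → Rounds ω i (count (τ ⟪ ω ⟫) 0F i) (count (τ ⟪ ω ⟫) 1F i)

  2≤d+p : 2 ≤ d + p
  2≤d+p = +-mono-≤ (>-nonZero⁻¹ d) (>-nonZero⁻¹ p)

  rounds-block-0 : (∀ {j} → j < i → RoundsAt j) → ω 0 ≡ 0F →
    Rounds ω i (count (τ ⟪ ω ⟫) 0F i) (count (τ ⟪ ω ⟫) 1F i)
  rounds-block-0 {i} {ω} rec ω0≡0 with i ≤? d
  ... | yes i≤d = rounds-prefix
          (prefix-zeros {ω} (replicate p 1F) (trans (cong (image τ) ω0≡0) image-0) i≤d)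
          (∣replicate∣-same 0F i) (∣replicate∣-other 1≢0 i) (rounds-0 i≤d)
  ... | no i≰d with s , refl ← m≤n⇒∃[o]m+o≡n (<⇒≤ (≰⇒> i≰d)) with s ≤? p
  ...   | yes s≤p = rounds-prefix {ω} (prefix-block {ω} ω0≡0 s≤p) (∣block∣₀ s) (∣block∣₁ s)
            -- The only base case in which the two roundings differ: `k` is 0 for the floor and 1
            -- for the ceiling.
            ( floor-0 ≤-refl
            , 1
            , subst (λ Z → Approximates ω (d + s) Z 1) (+-identityʳ d)
                (approximates-zero ω0≡0 2≤d+s (approximates-0 z≤n))
            , subst (λ z → s ≤ p * z) (sym (count-head ω ω0≡0 0F 0)) (subst (s ≤_) (sym (*-identityʳ p)) s≤p) )
    where
    2≤d+s : 2 ≤ d + s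
    2≤d+s = +-mono-≤ (>-nonZero⁻¹ d)
      (+-cancelˡ-≤ d 1 s (subst (_≤ d + s) (+-comm 1 d) (≰⇒> i≰d)))
  ...   | no s≰p with j , refl ← m≤n⇒∃[o]m+o≡n (<⇒≤ (≰⇒> s≰p)) =
    subst₂ (Rounds ω (d + (p + j)))
      (sym (trans (beyond 0F) (cong (_+ count (τ ⟪ ω ∘ suc ⟫) 0F j) (∣block∣₀ p))))
      (sym (trans (beyond 1F) (cong (_+ count (τ ⟪ ω ∘ suc ⟫) 1F j) (∣block∣₁ p))))
      (rounds-zero ω0≡0 2+j≤i (rec (<⇒≤ 2+j≤i) (ω ∘ suc)))
    where
    2+j≤i : 2 + j ≤ d + (p + j)
    2+j≤i = subst (2 + j ≤_) (+-assoc d p j) (+-monoˡ-≤ j 2≤d+p)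
    beyond : ∀ a → count (τ ⟪ ω ⟫) a (d + (p + j)) ≡
      ∣ replicate d 0F ++ replicate p 1F ∣₍ a ₎ + count (τ ⟪ ω ∘ suc ⟫) a j
    beyond a = trans (cong (count (τ ⟪ ω ⟫) a) (sym (+-assoc d p j)))
      (count-beyond {ω} (trans (cong (image τ) ω0≡0) image-0)
        (trans (length-++ (replicate d 0F)) (cong₂ _+_ (length-replicate d) (length-replicate p))) a j)

  rounds-block-1 : (∀ {j} → j < i → RoundsAt j) → ω 0 ≡ 1F →
    Rounds ω i (count (τ ⟪ ω ⟫) 0F i) (count (τ ⟪ ω ⟫) 1F i)
  rounds-block-1 {i} {ω} rec ω0≡1 with i ≤? q
  -- A cut inside the image of 1 leaves up to `q` zeros as remainder, which `q≤d` keeps within the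
  -- allowed range.
  ... | yes i≤q = rounds-prefix {ω}
          (prefix-zeros {ω} [] (trans (trans (cong (image τ) ω0≡1) image-1) (sym (++-identityʳ _))) i≤q)
          (∣replicate∣-same 0F i) (∣replicate∣-other 1≢0 i) (rounds-0 (≤-trans i≤q q≤d))
  ... | no i≰q with j , refl ← m≤n⇒∃[o]m+o≡n (<⇒≤ (≰⇒> i≰q)) =
    subst₂ (Rounds ω (q + j))
      (sym (trans (beyond 0F) (cong (_+ count (τ ⟪ ω ∘ suc ⟫) 0F j) (∣replicate∣-same 0F q))))
      (sym (trans (beyond 1F) (cong (_+ count (τ ⟪ ω ∘ suc ⟫) 1F j) (∣replicate∣-other 1≢0 q))))
      (rounds-one ω0≡1 (rec (+-monoˡ-≤ j (>-nonZero⁻¹ q)) (ω ∘ suc)))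
    where
    beyond : ∀ a → count (τ ⟪ ω ⟫) a (q + j) ≡ ∣ replicate q 0F ∣₍ a ₎ + count (τ ⟪ ω ∘ suc ⟫) a j
    beyond a = count-beyond {ω} (trans (cong (image τ) ω0≡1) image-1) (length-replicate q) a j

  -- Strong induction, because peeling off the first block shortens the prefix by the length of that
  -- block.
  rounds : ∀ i → RoundsAt i
  rounds = <-rec RoundsAt step
    where
    step : ∀ i → (∀ {j} → j < i → RoundsAt j) → RoundsAt i
    step i rec ω = [ rounds-block-0 {i} {ω} rec , rounds-block-1 {i} {ω} rec ]′ (letter (ω 0))

-- Balance along a sequence of substitutions

-- Each quantity will be a sum over two endpoints, hence the bound 2d on `rb`. The inequality for
-- the 1s, divided by p, gives the one for `za`. Then d (za - zb) is at least d (c + 2), of which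
-- the remainders absorb at most 2d, so q (ob - oa) exceeds d c + c + 1. By the size condition this
-- is at least (c + 1) p q, and dividing by q finishes.
descent : ∀ {c d p q} .{{_ : NonZero p}} .{{_ : NonZero q}} → suc c * (p * q) < d * c + (2 + c) →
  ∀ {Oa Ob Za Zb za zb oa ob ra rb} →
  Oa ≤ p * za → p * zb ≤ Ob →
  Za ≡ d * za + q * oa + ra → Zb ≡ d * zb + q * ob + rb → rb ≤ d + d →
  Ob + suc c * p < Oa → Za + suc c < Zb →
  oa + suc c * p < ob × zb + suc c < za
descent {c} {d} {p} {q} cond {Oa} {Ob} {Za} {Zb} {za} {zb} {oa} {ob} {ra} {rb}
  Oa≤ ≤Ob refl refl rb≤2d O< Z< = o< , z<
  where
  z< : zb + suc c < za
  z< = *-cancelˡ-< p (zb + suc c) za (begin-strict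
    p * (zb + suc c)     ≡⟨ arith p zb c ⟩
    p * zb + suc c * p   ≤⟨ +-monoˡ-≤ (suc c * p) ≤Ob ⟩
    Ob + suc c * p       <⟨ O< ⟩
    Oa                   ≤⟨ Oa≤ ⟩
    p * za               ∎)
    where
    open ≤-Reasoning
    arith : ∀ p z c → p * (z + suc c) ≡ p * z + suc c * p
    arith = solve-∀
  o< : oa + suc c * p < ob
  o< = *-cancelˡ-< q (oa + suc c * p) ob (+-cancelˡ-< (d * zb + (d + d)) _ _ (begin-strict
    d * zb + (d + d) + q * (oa + suc c * p)             ≡⟨ arith₁ d zb q oa c p ⟩
    d * zb + (d + d) + q * oa + suc c * (p * q)         ≤⟨ +-monoʳ-≤ (d * zb + (d + d) + q * oa) (s≤s⁻¹ cond′) ⟩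
    d * zb + (d + d) + q * oa + (d * c + suc c)         ≡⟨ arith₂ d zb q oa c ⟩
    -- Integrality is used here: the strict inequality `z<` yields c + 2 multiples of d rather than
    -- c + 1.
    d * suc (zb + suc c) + q * oa + suc c               ≤⟨ +-monoˡ-≤ (suc c) (+-monoˡ-≤ (q * oa) (*-monoʳ-≤ d z<)) ⟩
    d * za + q * oa + suc c                             ≤⟨ +-monoˡ-≤ (suc c) (m≤m+n _ ra) ⟩
    d * za + q * oa + ra + suc c                        <⟨ Z< ⟩
    d * zb + q * ob + rb                                ≤⟨ +-monoʳ-≤ (d * zb + q * ob) rb≤2d ⟩
    d * zb + q * ob + (d + d)                           ≡⟨ arith₃ (d * zb) (q * ob) (d + d) ⟩
    d * zb + (d + d) + q * ob                           ∎))
    where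
    open ≤-Reasoning
    cond′ : suc c * (p * q) < suc (d * c + suc c)
    cond′ = subst (suc c * (p * q) <_) (+-suc (d * c) (suc c)) cond
    arith₁ : ∀ d z q o c p → d * z + (d + d) + q * (o + suc c * p) ≡ d * z + (d + d) + q * o + suc c * (p * q)
    arith₁ = solve-∀
    arith₂ : ∀ d z q o c → d * z + (d + d) + q * o + (d * c + suc c) ≡ d * suc (z + suc c) + q * o + suc c
    arith₂ = solve-∀
    arith₃ : ∀ x y z → x + y + z ≡ x + z + y
    arith₃ = solve-∀

-- The factors ω[b₁, a₁) and ω[a₂, b₂) differ by more than C in their 1s and, the
-- other way round, by more than D in their 0s. The inequalities are moved to sums,
-- so that the endpoints need not be ordered.
Unbalanced : ℕ → ℕ → Word → (a₁ a₂ b₁ b₂ : ℕ) → Set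
Unbalanced C D ω a₁ a₂ b₁ b₂ =
  count ω 1F b₁ + count ω 1F b₂ + C < count ω 1F a₁ + count ω 1F a₂ ×
  count ω 0F a₁ + count ω 0F a₂ + D < count ω 0F b₁ + count ω 0F b₂

unbalanced-cong : ∀ {C D ω ω′} → ω ≗ ω′ → ∀ {a₁ a₂ b₁ b₂} →
  Unbalanced C D ω a₁ a₂ b₁ b₂ → Unbalanced C D ω′ a₁ a₂ b₁ b₂
unbalanced-cong {C} {D} {ω} {ω′} ω≗ω′ {a₁} {a₂} {b₁} {b₂} (ones , zeros) =
    subst₂ (λ x y → x + C < y) (eq 1F b₁ b₂) (eq 1F a₁ a₂) ones ,
    subst₂ (λ x y → x + D < y) (eq 0F a₁ a₂) (eq 0F b₁ b₂) zeros
  where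
  eq : ∀ a i j → count ω a i + count ω a j ≡ count ω′ a i + count ω′ a j
  eq a i j = cong₂ (λ u v → ∣ u ∣₍ a ₎ + ∣ v ∣₍ a ₎) (applyUpTo-cong ω≗ω′ i) (applyUpTo-cong ω≗ω′ j)

factor-count : ∀ {ν : Word} {u k} → u ≡ applyUpTo (λ i → ν (k + i)) (length u) → ∀ a →
  count ν a (k + length u) ≡ count ν a k + ∣ u ∣₍ a ₎
factor-count {ν} {u} {k} eq a = trans (cong ∣_∣₍ a ₎ (applyUpTo-+ ν k (length u)))
  (trans (∣++∣ a (applyUpTo ν k) _) (cong (λ v → count ν a k + ∣ v ∣₍ a ₎) (sym eq)))

-- At equal lengths a surplus of 0s in one factor is a surplus of 1s in the other, so it is enough
-- to bound the 1s in both directions.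
length≡⇒∣∣₀≤ : ∀ {C u v} → length u ≡ length v → ∣ v ∣₍ 1F ₎ ≤ ∣ u ∣₍ 1F ₎ + C → ∣ u ∣₍ 0F ₎ ≤ ∣ v ∣₍ 0F ₎ + C
length≡⇒∣∣₀≤ {C} {u} {v} ∣u∣≡∣v∣ v≤u = +-cancelʳ-≤ (∣ u ∣₍ 1F ₎) _ _ (begin
  ∣ u ∣₍ 0F ₎ + ∣ u ∣₍ 1F ₎            ≡⟨ ∣∣-total u ⟩
  length u                             ≡⟨ ∣u∣≡∣v∣ ⟩
  length v                             ≡⟨ ∣∣-total v ⟨
  ∣ v ∣₍ 0F ₎ + ∣ v ∣₍ 1F ₎            ≤⟨ +-monoʳ-≤ ∣ v ∣₍ 0F ₎ v≤u ⟩
  ∣ v ∣₍ 0F ₎ + (∣ u ∣₍ 1F ₎ + C)      ≡⟨ arith ∣ v ∣₍ 0F ₎ ∣ u ∣₍ 1F ₎ C ⟩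
  ∣ v ∣₍ 0F ₎ + C + ∣ u ∣₍ 1F ₎        ∎)
  where
  open ≤-Reasoning
  arith : ∀ a b c → a + (b + c) ≡ a + c + b
  arith = solve-∀

∣m-n∣≤ : ∀ {m n C} → m ≤ n + C → n ≤ m + C →
  ℤ.- (ℤ.+ C) ℤ.≤ ℤ.+ m ℤ.- ℤ.+ n × ℤ.+ m ℤ.- ℤ.+ n ℤ.≤ ℤ.+ C
∣m-n∣≤ {m} {n} {C} m≤n+C n≤m+C = lower , upper m≤n+C
  where
  upper : ∀ {m n} → m ≤ n + C → ℤ.+ m ℤ.- ℤ.+ n ℤ.≤ ℤ.+ C
  upper {m} {n} m≤n+C = ℤ.≤-trans (ℤ.+-monoˡ-≤ (ℤ.- (ℤ.+ n)) (ℤ.+≤+ m≤n+C))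
    (ℤ.≤-reflexive (trans (ℤ.m-n≡m⊖n (n + C) n) (trans (ℤ.⊖-≥ (m≤m+n n C)) (cong ℤ.+_ (m+n∸m≡n n C)))))
  swap : ℤ.- (ℤ.+ n ℤ.- ℤ.+ m) ≡ ℤ.+ m ℤ.- ℤ.+ n
  swap = trans (cong ℤ.-_ (ℤ.m-n≡m⊖n n m)) (trans (sym (ℤ.⊖-swap m n)) (sym (ℤ.m-n≡m⊖n m n)))
  lower : ℤ.- (ℤ.+ C) ℤ.≤ ℤ.+ m ℤ.- ℤ.+ n
  lower = subst (ℤ.- (ℤ.+ C) ℤ.≤_) swap (ℤ.neg-mono-≤ (upper n≤m+C))

module Balance {c p q : ℕ} .{{_ : NonZero p}} .{{_ : NonZero q}} {d : ℕ → ℕ} {τ : ℕ → Substitution}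
  (q≤d : ∀ n → q ≤ d n) (block : ∀ n → IsBlock (d n) p q (τ n))
  (large : ∀ n → suc c * (p * q) < d n * c + (2 + c))
  {ω : ℕ → Word} (desubst : ∀ n → ω n ≗ τ n ⟪ ω (suc n) ⟫) where

  C : ℕ
  C = suc c * p

  module Round (n : ℕ) = Rounding {{>-nonZero (≤-trans (>-nonZero⁻¹ q) (q≤d n))}} (q≤d n) (block n)
  open Round using (approx)

  round-floor : ∀ n i → Round.Floor n (ω (suc n)) i (count (τ n ⟪ ω (suc n) ⟫) 0F i) (count (τ n ⟪ ω (suc n) ⟫) 1F i)
  round-floor n i = proj₁ (Round.rounds n i (ω (suc n)))

  round-ceiling : ∀ n i → Round.Ceiling n (ω (suc n)) i (count (τ n ⟪ ω (suc n) ⟫) 0F i) (count (τ n ⟪ ω (suc n) ⟫) 1F i)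
  round-ceiling n i = proj₂ (Round.rounds n i (ω (suc n)))

  -- Infinite descent on the sum of the four positions, with `m` as a strict bound for it. The 1s
  -- before the `a` positions are rounded up and those before the `b` positions down, as `descent`
  -- requires; its result is unbalanced one level up with the two pairs exchanged.
  ¬unbalanced : ∀ m n a₁ a₂ b₁ b₂ → a₁ + a₂ + (b₁ + b₂) < m →
    ¬ Unbalanced C (suc c) (ω n) a₁ a₂ b₁ b₂
  ¬unbalanced (suc m) n a₁ a₂ b₁ b₂ (s≤s pos≤m) unb
    with ones , zeros ← unbalanced-cong {C} {suc c} (desubst n) {a₁} {a₂} {b₁} {b₂} unb
    with k₁ , approx r₁ r₁≤d Z₁≡ k₁≤ , O₁≤ ← round-ceiling n a₁
       | k₂ , approx r₂ r₂≤d Z₂≡ k₂≤ , O₂≤ ← round-ceiling n a₂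
       | l₁ , approx s₁ s₁≤d Y₁≡ l₁≤ , ≤O₁ ← round-floor n b₁
       | l₂ , approx s₂ s₂≤d Y₂≡ l₂≤ , ≤O₂ ← round-floor n b₂
    = ¬unbalanced m (suc n) l₁ l₂ k₁ k₂ smaller next
    where
    z o : ℕ → ℕ
    z = count (ω (suc n)) 0F
    o = count (ω (suc n)) 1F
    arith : ∀ d q z₁ o₁ r₁ z₂ o₂ r₂ → d * z₁ + q * o₁ + r₁ + (d * z₂ + q * o₂ + r₂) ≡
      d * (z₁ + z₂) + q * (o₁ + o₂) + (r₁ + r₂)
    arith = solve-∀
    next : Unbalanced C (suc c) (ω (suc n)) l₁ l₂ k₁ k₂
    next = descent {c} {d n} {p} {q} (large n)
      (≤-trans (+-mono-≤ O₁≤ O₂≤) (≤-reflexive (sym (*-distribˡ-+ p (z k₁) (z k₂)))))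
      (≤-trans (≤-reflexive (*-distribˡ-+ p (z l₁) (z l₂))) (+-mono-≤ ≤O₁ ≤O₂))
      (trans (cong₂ _+_ Z₁≡ Z₂≡) (arith (d n) q (z k₁) (o k₁) r₁ (z k₂) (o k₂) r₂))
      (trans (cong₂ _+_ Y₁≡ Y₂≡) (arith (d n) q (z l₁) (o l₁) s₁ (z l₂) (o l₂) s₂))
      (+-mono-≤ s₁≤d s₂≤d) ones zeros
    smaller : l₁ + l₂ + (k₁ + k₂) < m
    smaller = begin-strict
      l₁ + l₂ + (k₁ + k₂)                                   ≡⟨ +-comm (l₁ + l₂) (k₁ + k₂) ⟩
      -- Strictness comes from the inequality for the 0s in `next`, which forces a 0 before `k₁` or
      -- `k₂`; the field `bound` leaves room for it.
      k₁ + k₂ + (l₁ + l₂)                                   <⟨ +-monoˡ-< (l₁ + l₂) (m<m+n (k₁ + k₂) (≤-trans (s≤s z≤n) (proj₂ next))) ⟩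
      k₁ + k₂ + (z k₁ + z k₂) + (l₁ + l₂)                   ≡⟨ cong (_+ (l₁ + l₂)) (interchange k₁ k₂ (z k₁) (z k₂)) ⟩
      k₁ + z k₁ + (k₂ + z k₂) + (l₁ + l₂)                   ≤⟨ +-mono-≤ (+-mono-≤ k₁≤ k₂≤)
                                                                (+-mono-≤ (m+n≤o⇒m≤o l₁ l₁≤) (m+n≤o⇒m≤o l₂ l₂≤)) ⟩
      a₁ + a₂ + (b₁ + b₂)                                   ≤⟨ pos≤m ⟩
      m                                                     ∎
      where
      open ≤-Reasoning
      interchange : ∀ a b c d → a + b + (c + d) ≡ a + c + (b + d)
      interchange = solve-∀

  -- If `u` had more than `C` surplus 1s, then by equality of lengths `v` would have more than `C`
  -- surplus 0s, and `C` is at least `suc c`. The endpoints of the two factors would then be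
  -- unbalanced at level 0.
  ones-close : ∀ {ν : Word} → ω 0 ≗ ν → ∀ {u v} → IsFactor ν u → IsFactor ν v → length u ≡ length v →
    ∣ u ∣₍ 1F ₎ ≤ ∣ v ∣₍ 1F ₎ + C
  ones-close {ν} ω≗ν {u} {v} (k , u≡) (l , v≡) ∣u∣≡∣v∣ = ≮⇒≥ λ far →
      ¬unbalanced (suc (a₁ + l + (k + b₂))) 0 a₁ l k b₂ ≤-refl
        (unbalanced-cong {C} {suc c} (λ i → sym (ω≗ν i)) {a₁} {l} {k} {b₂} (ones far , zeros far))
    where
    a₁ b₂ : ℕ
    a₁ = k + length u
    b₂ = l + length v
    ones : ∣ v ∣₍ 1F ₎ + C < ∣ u ∣₍ 1F ₎ → count ν 1F k + count ν 1F b₂ + C < count ν 1F a₁ + count ν 1F l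
    ones far = begin-strict
      count ν 1F k + count ν 1F b₂ + C                     ≡⟨ cong (λ x → count ν 1F k + x + C) (factor-count {ν} v≡ 1F) ⟩
      count ν 1F k + (count ν 1F l + ∣ v ∣₍ 1F ₎) + C      ≡⟨ arith₁ (count ν 1F k) (count ν 1F l) ∣ v ∣₍ 1F ₎ C ⟩
      count ν 1F k + count ν 1F l + (∣ v ∣₍ 1F ₎ + C)      <⟨ +-monoʳ-< (count ν 1F k + count ν 1F l) far ⟩
      count ν 1F k + count ν 1F l + ∣ u ∣₍ 1F ₎            ≡⟨ arith₂ (count ν 1F k) (count ν 1F l) ∣ u ∣₍ 1F ₎ ⟩
      count ν 1F k + ∣ u ∣₍ 1F ₎ + count ν 1F l            ≡⟨ cong (_+ count ν 1F l) (factor-count {ν} u≡ 1F) ⟨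
      count ν 1F a₁ + count ν 1F l                         ∎
      where
      open ≤-Reasoning
      arith₁ : ∀ a b c d → a + (b + c) + d ≡ a + b + (c + d)
      arith₁ = solve-∀
      arith₂ : ∀ a b c → a + b + c ≡ a + c + b
      arith₂ = solve-∀
    fewer : ∣ v ∣₍ 1F ₎ + C < ∣ u ∣₍ 1F ₎ → ∣ u ∣₍ 0F ₎ + suc c < ∣ v ∣₍ 0F ₎
    fewer far = +-cancelʳ-< (∣ v ∣₍ 1F ₎) _ _ (begin-strict
      ∣ u ∣₍ 0F ₎ + suc c + ∣ v ∣₍ 1F ₎        ≡⟨ arith ∣ u ∣₍ 0F ₎ (suc c) ∣ v ∣₍ 1F ₎ ⟩
      ∣ u ∣₍ 0F ₎ + (∣ v ∣₍ 1F ₎ + suc c)      ≤⟨ +-monoʳ-≤ ∣ u ∣₍ 0F ₎ (+-monoʳ-≤ ∣ v ∣₍ 1F ₎ (m≤m*n (suc c) p)) ⟩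
      ∣ u ∣₍ 0F ₎ + (∣ v ∣₍ 1F ₎ + C)          <⟨ +-monoʳ-< ∣ u ∣₍ 0F ₎ far ⟩
      ∣ u ∣₍ 0F ₎ + ∣ u ∣₍ 1F ₎                ≡⟨ ∣∣-total u ⟩
      length u                                 ≡⟨ ∣u∣≡∣v∣ ⟩
      length v                                 ≡⟨ ∣∣-total v ⟨
      ∣ v ∣₍ 0F ₎ + ∣ v ∣₍ 1F ₎                ∎)
      where
      open ≤-Reasoning
      arith : ∀ a b c → a + b + c ≡ a + (c + b)
      arith = solve-∀
    zeros : ∣ v ∣₍ 1F ₎ + C < ∣ u ∣₍ 1F ₎ → count ν 0F a₁ + count ν 0F l + suc c < count ν 0F k + count ν 0F b₂
    zeros far = begin-strict
      count ν 0F a₁ + count ν 0F l + suc c                     ≡⟨ cong (λ x → x + count ν 0F l + suc c) (factor-count {ν} u≡ 0F) ⟩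
      count ν 0F k + ∣ u ∣₍ 0F ₎ + count ν 0F l + suc c        ≡⟨ arith₁ (count ν 0F k) ∣ u ∣₍ 0F ₎ (count ν 0F l) (suc c) ⟩
      count ν 0F k + count ν 0F l + (∣ u ∣₍ 0F ₎ + suc c)      <⟨ +-monoʳ-< (count ν 0F k + count ν 0F l) (fewer far) ⟩
      count ν 0F k + count ν 0F l + ∣ v ∣₍ 0F ₎                ≡⟨ +-assoc (count ν 0F k) _ _ ⟩
      count ν 0F k + (count ν 0F l + ∣ v ∣₍ 0F ₎)              ≡⟨ cong (count ν 0F k +_) (factor-count {ν} v≡ 0F) ⟨
      count ν 0F k + count ν 0F b₂                             ∎
      where
      open ≤-Reasoning
      arith₁ : ∀ a b c d → a + b + c + d ≡ a + c + (b + d)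
      arith₁ = solve-∀

  balanced : ∀ {ν} → ω 0 ≗ ν → Balanced C ν
  balanced ω≗ν u v fu fv ∣u∣≡∣v∣ 1F =
    ∣m-n∣≤ (ones-close ω≗ν fu fv ∣u∣≡∣v∣) (ones-close ω≗ν fv fu (sym ∣u∣≡∣v∣))
  balanced ω≗ν u v fu fv ∣u∣≡∣v∣ 0F =
    ∣m-n∣≤ (length≡⇒∣∣₀≤ {u = u} {v} ∣u∣≡∣v∣ (ones-close ω≗ν fv fu (sym ∣u∣≡∣v∣)))
      (length≡⇒∣∣₀≤ {u = v} {u} (sym ∣u∣≡∣v∣) (ones-close ω≗ν fu fv ∣u∣≡∣v∣))

-- Existence and uniqueness of the desubstituted word

module Limit {p q : ℕ} .{{_ : NonZero p}} .{{_ : NonZero q}} {d : ℕ → ℕ} {τ : ℕ → Substitution}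
  (0<d : ∀ n → 0 < d n) (block : ∀ n → IsBlock (d n) p q (τ n)) where

  head-++ : ∀ {m} → 0 < m → ∀ u ω → ((replicate m 0F ++ u) ▹ ω) 0 ≡ 0F
  head-++ (s≤s _) u ω = refl

  -- Both images start with 0 because `d n` and `q` are positive. Hence every word of a family
  -- starts with 0, and its image starts with the block of 0, which has at least two letters.
  head-0 : ∀ n ω → (τ n ⟪ ω ⟫) 0 ≡ 0F
  head-0 n ω = trans (unfold (τ n) ω 0) ([ zero-block , one-block ]′ (letter (ω 0)))
    where
    open IsBlock (block n)
    W = τ n ⟪ ω ∘ suc ⟫
    zero-block : ω 0 ≡ 0F → (image (τ n) (ω 0) ▹ W) 0 ≡ 0F
    zero-block eq = trans (cong (λ u → (u ▹ W) 0) (trans (cong (image (τ n)) eq) image-0))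
      (head-++ (0<d n) _ W)
    one-block : ω 0 ≡ 1F → (image (τ n) (ω 0) ▹ W) 0 ≡ 0F
    one-block eq = trans (cong (λ u → (u ▹ W) 0)
        (trans (cong (image (τ n)) eq) (trans image-1 (sym (++-identityʳ _)))))
      (head-++ (>-nonZero⁻¹ q) [] W)

  image-0-long : ∀ n → 2 ≤ length (image (τ n) 0F)
  image-0-long n = subst (2 ≤_) (sym (trans (cong length (IsBlock.image-0 (block n)))
    (trans (length-++ (replicate (d n) 0F)) (cong₂ _+_ (length-replicate (d n)) (length-replicate p)))))
    (+-mono-≤ (0<d n) (>-nonZero⁻¹ p))

  -- The first block has length at least 2, so a prefix of length m determines a
  -- longer prefix of the image.
  agree-suc : ∀ n m {ω ω′} → ω 0 ≡ 0F → ω′ 0 ≡ 0F → ω ≈[ m ] ω′ →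
    τ n ⟪ ω ⟫ ≈[ suc m ] τ n ⟪ ω′ ⟫
  agree-suc n m {ω} {ω′} ω0≡0 ω′0≡0 agree i≤m = ⟪⟫-agree-head (τ n) {ω = ω} {ω′} ω0≡0 ω′0≡0
    -- The tails agree on `pred m` letters and the common first block adds two or more, which makes
    -- at least `suc m`. The use of `pred` covers m = 0 as well.
    (⟪⟫-agree (τ n) (pred m) tails)
    (<-≤-trans i≤m (≤-trans (s≤s (suc-pred-≤ m)) (+-monoˡ-≤ (pred m) (image-0-long n))))
    where
    suc-pred-≤ : ∀ m → m ≤ suc (pred m)
    suc-pred-≤ zero    = z≤n
    suc-pred-≤ (suc m) = ≤-refl
    tails : ω ∘ suc ≈[ pred m ] ω′ ∘ suc
    tails i<m-1 = agree (pred-cancel-< i<m-1)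

  Family : (ℕ → Word) → Set
  Family w = ∀ n → w n ≗ τ n ⟪ w (suc n) ⟫

  family-head-0 : ∀ {w} → Family w → ∀ n → w n 0 ≡ 0F
  family-head-0 {w} fam n = trans (fam n 0) (head-0 n (w (suc n)))

  -- Each substitution gains one letter of agreement, so agreement on `m` letters at level `n` rests
  -- on the empty agreement at level n + m.
  family-unique : ∀ {w w′} → Family w → Family w′ → ∀ m n → w n ≈[ m ] w′ n
  family-unique fam fam′ (suc m) n {i} i≤m = trans (fam n i) (trans
    (agree-suc n m (family-head-0 fam (suc n)) (family-head-0 fam′ (suc n))
      (family-unique fam fam′ m (suc n)) i≤m)
    (sym (fam′ n i)))

  -- The seed sits at level n + k. It starts with 0, as `agree-suc` demands.
  approximant : ℕ → ℕ → Word
  approximant zero    n = λ _ → 0F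
  approximant (suc k) n = τ n ⟪ approximant k (suc n) ⟫

  approximant-head-0 : ∀ k n → approximant k n 0 ≡ 0F
  approximant-head-0 zero    n = refl
  approximant-head-0 (suc k) n = head-0 n (approximant k (suc n))

  approximant-stable : ∀ k j n → approximant k n ≈[ k ] approximant (k + j) n
  approximant-stable (suc k) j n = agree-suc n k (approximant-head-0 k (suc n))
    (approximant-head-0 (k + j) (suc n)) (approximant-stable k j (suc n))

  -- By `approximant-stable`, letter `i` is settled from the approximant of index i + 1 on.
  limit : ℕ → Word
  limit n i = approximant (suc i) n i

  limit-agree : ∀ k n → approximant k n ≈[ k ] limit n
  limit-agree k n {i} i<k with j , refl ← m≤n⇒∃[o]m+o≡n i<k =
    sym (approximant-stable (suc i) j n ≤-refl)

  -- Letter `i` is read off the image of `approximant i (suc n)`. That word agrees with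
  -- `limit (suc n)` on only `i` letters, and `agree-suc` supplies the missing one.
  limit-family : Family limit
  limit-family n i = agree-suc n i (approximant-head-0 i (suc n)) (approximant-head-0 1 (suc n))
    (limit-agree i (suc n)) ≤-refl

  desubstitutes-unique : ∃! _≗_ (Desubstitutes τ)
  desubstitutes-unique = limit 0 , (limit , (λ _ → refl) , limit-family) ,
    λ { (w , w0≗ω , fam) i → trans (family-unique limit-family fam (suc i) 0 ≤-refl) (w0≗ω i) }

-- Balance of the NCF and dual NCF words

theWord-balanced : ∀ {c p q} .{{_ : NonZero p}} .{{_ : NonZero q}} {d : ℕ → ℕ} {τ : ℕ → Substitution} →
  (∀ n → q ≤ d n) → (∀ n → IsBlock (d n) p q (τ n)) →
  (∀ n → suc c * (p * q) < d n * c + (2 + c)) →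
  TheWord (Desubstitutes τ) (Balanced (suc c * p))
theWord-balanced {q = q} q≤d block large =
  Limit.desubstitutes-unique (λ n → ≤-trans (>-nonZero⁻¹ q) (q≤d n)) block ,
  λ { ω (w , w0≗ω , fam) → Balance.balanced q≤d block large {w} fam w0≗ω }

-- The size condition for C = p q = N: when d ≥ N, the right-hand side is at least N (N - 1) + N +
-- 1, one more than N squared.
large-N : ∀ {c d} → suc c ≤ d → suc c * suc c < d * c + (2 + c)
large-N {c} {d} c<d = begin-strict
  suc c * suc c            ≡⟨ arith c ⟩
  suc c * c + suc c        ≤⟨ +-monoˡ-≤ (suc c) (*-monoˡ-≤ c c<d) ⟩
  d * c + suc c            <⟨ +-monoʳ-< (d * c) (n<1+n (suc c)) ⟩
  d * c + (2 + c)          ∎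
  where
  open ≤-Reasoning
  arith : ∀ c → suc c * suc c ≡ suc c * c + suc c
  arith = solve-∀

large-2 : ∀ {N d} → 2 * N ≤ d → 2 * N < d * 1 + (2 + 1)
large-2 {N} {d} 2N≤d = ≤-<-trans 2N≤d (subst (_< d * 1 + 3) (*-identityʳ d) (m<m+n (d * 1) (s≤s z≤n)))

toList-++⁺ : ∀ (u : List Letter) v → List⁺.toList (u List⁺.++⁺ v) ≡ u ++ List⁺.toList v
toList-++⁺ []      v = refl
toList-++⁺ (a ∷ u) v = cong (a ∷_) (toList-++⁺ u v)

module _ (N : ℕ) .{{_ : NonZero N}} where

  toList-^N : ∀ a → List⁺.toList (_^N N a) ≡ replicate N a
  toList-^N a = cong (λ n → replicate n a) (suc-pred N)

  σ-block : ∀ d → IsBlock d N 1 (σ N d)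
  σ-block d = record
    { image-0 = trans (toList-++⁺ (replicate d 0F) _) (cong (replicate d 0F ++_) (toList-^N 1F))
    ; image-1 = refl
    }

  σ̂-block : ∀ d → IsBlock d 1 N (σ̂ N d)
  σ̂-block d = record
    { image-0 = toList-++⁺ (replicate d 0F) _
    ; image-1 = toList-^N 0F
    }

  module _ (d : ℕ → ℕ) (N≤d : ∀ n → N ≤ d n) where

    -- Here p = N and q = 1, whereas the dual substitution has p = 1 and q = N. The product p q, and
    -- with it the size condition, is the same; only the resulting bound differs, by a factor N.
    σ-balanced : ∀ {c C} → suc c * N ≡ C → (∀ n → suc c * N < d n * c + (2 + c)) →
      TheWord (Desubstitutes (λ n → σ N (d n))) (Balanced C)
    σ-balanced {c} refl large = theWord-balanced {c} {N} {1} {d = d}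
      (λ n → ≤-trans (>-nonZero⁻¹ N) (N≤d n)) (λ n → σ-block (d n))
      (λ n → subst (λ m → suc c * m < d n * c + (2 + c)) (sym (*-identityʳ N)) (large n))

    σ̂-balanced : ∀ {c C} → suc c ≡ C → (∀ n → suc c * N < d n * c + (2 + c)) →
      TheWord (Desubstitutes (λ n → σ̂ N (d n))) (Balanced C)
    σ̂-balanced {c} refl large =
      subst (λ C → TheWord (Desubstitutes (λ n → σ̂ N (d n))) (Balanced C)) (*-identityʳ (suc c))
        (theWord-balanced {c} {1} {N} {d = d} N≤d (λ n → σ̂-block (d n))
        (λ n → subst (λ m → suc c * m < d n * c + (2 + c)) (sym (*-identityˡ N)) (large n)))

    large-d : ∀ n → suc (pred N) * N < d n * pred N + (2 + pred N)
    large-d n = subst (λ m → suc (pred N) * m < d n * pred N + (2 + pred N)) (suc-pred N)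
      (large-N {pred N} {d n} (subst (_≤ d n) (sym (suc-pred N)) (N≤d n)))

    σ-N²-balanced : TheWord (Desubstitutes (λ n → σ N (d n))) (Balanced (N ^ 2))
    σ-N²-balanced = σ-balanced (cong₂ _*_ (suc-pred N) (sym (*-identityʳ N))) large-d

    σ̂-N-balanced : TheWord (Desubstitutes (λ n → σ̂ N (d n))) (Balanced N)
    σ̂-N-balanced = σ̂-balanced (suc-pred N) large-d

  module _ (d : ℕ → ℕ) (2N≤d : ∀ n → 2 * N ≤ d n) where

    N≤d : ∀ n → N ≤ d n
    N≤d n = ≤-trans (m≤m+n N (1 * N)) (2N≤d n)

    σ-2N-balanced : TheWord (Desubstitutes (λ n → σ N (d n))) (Balanced (2 * N))
    σ-2N-balanced = σ-balanced d N≤d {1} refl (λ n → large-2 {N} (2N≤d n))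

    σ̂-2-balanced : TheWord (Desubstitutes (λ n → σ̂ N (d n))) (Balanced 2)
    σ̂-2-balanced = σ̂-balanced d N≤d {1} refl (λ n → large-2 {N} (2N≤d n))

-- Itineraries of a coded dynamical system

-- `fold` puts the latest application outermost, while an itinerary strips the innermost one. The
-- induction absorbs the outer application into `g`.
fold-shift : ∀ {ℓ} {A : Set ℓ} (f : A → A) (g : A → ℕ) x k → g (fold x f (suc k)) ≡ g (fold (f x) f k)
fold-shift f g x zero    = refl
fold-shift f g x (suc k) = fold-shift f (g ∘ f) x k

fold-preserves : ∀ {ℓ r} {A : Set ℓ} (f : A → A) (_∼_ : A → A → Set r) →
  (∀ x y → x ∼ y → f x ∼ f y) → ∀ {x y} → x ∼ y → ∀ k → fold x f k ∼ fold y f k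
fold-preserves f _∼_ f-cong x∼y zero    = x∼y
fold-preserves f _∼_ f-cong x∼y (suc k) = f-cong _ _ (fold-preserves f _∼_ f-cong x∼y k)

-- `code` carries the shift to `f`, but only up to `∼`, so each step of the orbit is transported
-- along `∼` before the leading digit is read. `D` collects the admissible digit sequences.
fold-itinerary : ∀ {ℓ r s} {A : Set ℓ} (f : A → A) (g : A → ℕ) (_∼_ : A → A → Set r) →
  (∀ x y → x ∼ y → f x ∼ f y) → (∀ x y → x ∼ y → g x ≡ g y) →
  ∀ (D : (ℕ → ℕ) → Set s) (tail : ∀ {a} → D a → D (a ∘ suc)) (code : ∀ a → D a → A) →
  (∀ a d → g (code a d) ≡ a 0) → (∀ a d → f (code a d) ∼ code (a ∘ suc) (tail d)) →
  ∀ k a d → g (fold (code a d) f k) ≡ a k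
fold-itinerary f g _∼_ f-cong g-cong D tail code g-code f-code zero    a d = g-code a d
fold-itinerary f g _∼_ f-cong g-cong D tail code g-code f-code (suc k) a d =
  trans (fold-shift f g (code a d) k)
    (trans (g-cong _ _ (fold-preserves f _∼_ f-cong (f-code a d) k))
      (fold-itinerary f g _∼_ f-cong g-cong D tail code g-code f-code k (a ∘ suc) (tail d)))

-- Irrationals with prescribed digits

-- Integers are needed because the remainder N k - a₀ m in Euclid's algorithm may be negative.
ι : ℤ.ℤ → ℚ
ι i = i ℚ./ 1

toℚᵘ-ι : ∀ i → ℚ.toℚᵘ (ι i) ℚᵘ.≃ mkℚᵘ i 0
toℚᵘ-ι i = ℚ.toℚᵘ-fromℚᵘ (mkℚᵘ i 0)

ι-+ : ∀ i j → ι (i ℤ.+ j) ≡ ι i ℚ.+ ι j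
ι-+ i j = ℚ.toℚᵘ-injective (begin-equality
  ℚ.toℚᵘ (ι (i ℤ.+ j))                   ≃⟨ toℚᵘ-ι (i ℤ.+ j) ⟩
  mkℚᵘ (i ℤ.+ j) 0                       ≃⟨ ℚᵘ.*≡* (cong (ℤ._* ℤ.1ℤ) (sym (cong₂ ℤ._+_ (ℤ.*-identityʳ i) (ℤ.*-identityʳ j)))) ⟩
  mkℚᵘ i 0 ℚᵘ.+ mkℚᵘ j 0                 ≃⟨ ℚᵘ.+-cong (toℚᵘ-ι i) (toℚᵘ-ι j) ⟨
  ℚ.toℚᵘ (ι i) ℚᵘ.+ ℚ.toℚᵘ (ι j)         ≃⟨ ℚ.toℚᵘ-homo-+ (ι i) (ι j) ⟨
  ℚ.toℚᵘ (ι i ℚ.+ ι j)                   ∎)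
  where open ℚᵘ.≤-Reasoning

ι-* : ∀ i j → ι (i ℤ.* j) ≡ ι i ℚ.* ι j
ι-* i j = ℚ.toℚᵘ-injective (begin-equality
  ℚ.toℚᵘ (ι (i ℤ.* j))                   ≃⟨ toℚᵘ-ι (i ℤ.* j) ⟩
  mkℚᵘ i 0 ℚᵘ.* mkℚᵘ j 0                 ≃⟨ ℚᵘ.*-cong (toℚᵘ-ι i) (toℚᵘ-ι j) ⟨
  ℚ.toℚᵘ (ι i) ℚᵘ.* ℚ.toℚᵘ (ι j)         ≃⟨ ℚ.toℚᵘ-homo-* (ι i) (ι j) ⟨
  ℚ.toℚᵘ (ι i ℚ.* ι j)                   ∎)
  where open ℚᵘ.≤-Reasoning

ι-cancel-< : ∀ {i j} → ι i ℚ.< ι j → i ℤ.< j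
ι-cancel-< {i} {j} ιi<ιj
  with ℚᵘ.*<* i<j ← ℚᵘ.<-respˡ-≃ (toℚᵘ-ι i) (ℚᵘ.<-respʳ-≃ (toℚᵘ-ι j) (ℚ.toℚᵘ-mono-< ιi<ιj))
  = subst₂ ℤ._<_ (ℤ.*-identityʳ i) (ℤ.*-identityʳ j) i<j

ℕ→ℚ-mono-≤ : ∀ {m n} → m ≤ n → ℕ→ℚ m ℚ.≤ ℕ→ℚ n
ℕ→ℚ-mono-≤ {m} {n} m≤n = ℚ.≮⇒≥ λ n<m → ≤⇒≯ m≤n (ℤ.drop‿+<+ (ι-cancel-< n<m))

ℕ→ℚ-* : ∀ m n → ℕ→ℚ (m * n) ≡ ℕ→ℚ m ℚ.* ℕ→ℚ n
ℕ→ℚ-* m n = trans (cong ι (ℤ.pos-* m n)) (ι-* (ℤ.+ m) (ℤ.+ n))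

fraction : ∀ q → ∃[ i ] q ℚ.* ℕ→ℚ (ℚ.↧ₙ q) ≡ ι i
fraction q@record{} = ℚ.↥ q , ℚ.toℚᵘ-injective (begin-equality
  ℚ.toℚᵘ (q ℚ.* ℕ→ℚ (ℚ.↧ₙ q))                ≃⟨ ℚ.toℚᵘ-homo-* q (ℕ→ℚ (ℚ.↧ₙ q)) ⟩
  ℚ.toℚᵘ q ℚᵘ.* ℚ.toℚᵘ (ℕ→ℚ (ℚ.↧ₙ q))        ≃⟨ ℚᵘ.*-congˡ {ℚ.toℚᵘ q} (toℚᵘ-ι (ℤ.+ ℚ.↧ₙ q)) ⟩
  ℚ.toℚᵘ q ℚᵘ.* mkℚᵘ (ℚ.↧ q) 0               ≃⟨ ℚᵘ.*≡* (trans (ℤ.*-identityʳ _) (cong (λ d → ℚ.↥ q ℤ.* ℤ.+ d) (sym (*-identityʳ _)))) ⟩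
  mkℚᵘ (ℚ.↥ q) 0                             ≃⟨ toℚᵘ-ι (ℚ.↥ q) ⟨
  ℚ.toℚᵘ (ι (ℚ.↥ q))                         ∎)
  where open ℚᵘ.≤-Reasoning

+-cancelʳ-<ℚ : ∀ d {p q} → p ℚ.+ d ℚ.< q ℚ.+ d → p ℚ.< q
+-cancelʳ-<ℚ d {p} {q} lt = subst₂ ℚ._<_ ([q+d]-d≡q p d) ([q+d]-d≡q q d) (ℚ.+-monoˡ-< (ℚ.- d) lt)

ι-remainder : ∀ n k d m →
  ι (ℤ.+ (n * k) ℤ.- ℤ.+ (d * m)) ℚ.+ ℕ→ℚ d ℚ.* ℕ→ℚ m ≡ ℕ→ℚ n ℚ.* ℕ→ℚ k
ι-remainder n k d m = begin
  ι (ℤ.+ (n * k) ℤ.- ℤ.+ (d * m)) ℚ.+ ℕ→ℚ d ℚ.* ℕ→ℚ m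
    ≡⟨ cong (λ x → ι (ℤ.+ (n * k) ℤ.- ℤ.+ (d * m)) ℚ.+ x) (ℕ→ℚ-* d m) ⟨
  ι (ℤ.+ (n * k) ℤ.- ℤ.+ (d * m)) ℚ.+ ι (ℤ.+ (d * m))
    ≡⟨ ι-+ (ℤ.+ (n * k) ℤ.- ℤ.+ (d * m)) (ℤ.+ (d * m)) ⟨
  ι (ℤ.+ (n * k) ℤ.- ℤ.+ (d * m) ℤ.+ ℤ.+ (d * m))
    ≡⟨ cong ι (cancel (ℤ.+ (n * k)) (ℤ.+ (d * m))) ⟩
  ℕ→ℚ (n * k)
    ≡⟨ ℕ→ℚ-* n k ⟩
  ℕ→ℚ n ℚ.* ℕ→ℚ k ∎
  where
  open ≡-Reasoning
  cancel : ∀ i j → i ℤ.- j ℤ.+ j ≡ i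
  cancel i j = trans (ℤ.+-assoc i (ℤ.- j) j)
    (trans (cong (λ k → i ℤ.+ k) (ℤ.+-inverseˡ j)) (ℤ.+-identityʳ i))

-- For q = m / k the number r = n / q - d equals (n k - d m) / m, so the old numerator becomes the
-- new denominator.
euclid-step : ∀ r d q k n m x → (r ℚ.+ d) ℚ.* q ≡ n → q ℚ.* k ≡ m → x ℚ.+ d ℚ.* m ≡ n ℚ.* k → r ℚ.* m ≡ x
euclid-step r d q k n m x refl refl eq = begin
  r ℚ.* m                            ≡⟨ [q+d]-d≡q (r ℚ.* m) (d ℚ.* m) ⟨
  r ℚ.* m ℚ.+ d ℚ.* m ℚ.- d ℚ.* m    ≡⟨ cong (ℚ._- d ℚ.* m) (ℚ.*-distribʳ-+ m r d) ⟨
  (r ℚ.+ d) ℚ.* m ℚ.- d ℚ.* m        ≡⟨ cong (ℚ._- d ℚ.* m) (ℚ.*-assoc (r ℚ.+ d) q k) ⟨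
  n ℚ.* k ℚ.- d ℚ.* m                ≡⟨ cong (ℚ._- d ℚ.* m) eq ⟨
  x ℚ.+ d ℚ.* m ℚ.- d ℚ.* m          ≡⟨ [q+d]-d≡q x (d ℚ.* m) ⟩
  x                                  ∎
  where open ≡-Reasoning

positive-factor : ∀ {x q m} → 0ℚ ℚ.< m → 0ℚ ℚ.< q → x ℚ.* q ≡ m → 0ℚ ℚ.< x
positive-factor {x} {q} 0<m 0<q xq≡m =
  *-cancel-< 0<q (subst₂ ℚ._<_ (sym (ℚ.*-zeroˡ q)) (sym xq≡m) 0<m)

hyperbola-decreasing : ∀ {p q x y m} → 0ℚ ℚ.< m → 0ℚ ℚ.< p → p ℚ.< q → x ℚ.* q ≡ m → y ℚ.* p ≡ m → x ℚ.< y
hyperbola-decreasing {p} {q} {x} {y} 0<m 0<p p<q xq≡m yp≡m = *-cancel-< 0<p (begin-strict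
  x ℚ.* p    ≡⟨ ℚ.*-comm x p ⟩
  p ℚ.* x    <⟨ *-mono-< (positive-factor 0<m (ℚ.<-trans 0<p p<q) xq≡m) p<q ⟩
  q ℚ.* x    ≡⟨ trans (ℚ.*-comm q x) xq≡m ⟩
  _          ≡⟨ yp≡m ⟨
  y ℚ.* p    ∎)
  where open ℚ.≤-Reasoning

0≤ℕ→ℚ : ∀ m → 0ℚ ℚ.≤ ℕ→ℚ m
0≤ℕ→ℚ m = ℕ→ℚ-mono-≤ {0} {m} z≤n

0<r+d : ∀ {r} d → 0ℚ ℚ.< r → 0ℚ ℚ.< r ℚ.+ ℕ→ℚ d
0<r+d {r} d 0<r = subst (ℚ._< r ℚ.+ ℕ→ℚ d) (ℚ.+-identityʳ 0ℚ) (ℚ.+-mono-<-≤ 0<r (0≤ℕ→ℚ d))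

other : ℕ → ℕ → ℕ
other m d with d ≟ m
... | yes _ = suc m
... | no  _ = m

other-≢ : ∀ m d → other m d ≢ d
other-≢ m d with d ≟ m
... | yes refl = 1+n≢n
... | no  d≢m  = d≢m ∘ sym

m≤other : ∀ m d → m ≤ other m d
m≤other m d with d ≟ m
... | yes _ = n≤1+n m
... | no  _ = ≤-refl

-- The Dedekind cut of a continued fraction

module _ (N : ℕ) .{{_ : NonZero N}} where

  private
    n : ℚ
    n = ℕ→ℚ N
    0<n : 0ℚ ℚ.< n
    0<n = ℕ→ℚ-positive N

  -- The cut of x = N / (a₀ + x′): for q > 0, q < x iff x′ < N/q − a₀.
  mutual
    data Below (a : ℕ → ℕ) (q : ℚ) : Set where
      nonpositive : q ℚ.≤ 0ℚ → Below a q
      step        : ∀ r → 0ℚ ℚ.< q → (r ℚ.+ ℕ→ℚ (a 0)) ℚ.* q ≡ n → Above (a ∘ suc) r → Below a q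

    data Above (a : ℕ → ℕ) (q : ℚ) : Set where
      one≤ : 1ℚ ℚ.≤ q → Above a q
      step : ∀ r → 0ℚ ℚ.< q → (r ℚ.+ ℕ→ℚ (a 0)) ℚ.* q ≡ n → Below (a ∘ suc) r → Above a q

  private variable
    a   : ℕ → ℕ
    p q : ℚ

  above-positive : Above a q → 0ℚ ℚ.< q
  above-positive (one≤ 1≤q)     = ℚ.<-≤-trans (ℚ.positive⁻¹ 1ℚ) 1≤q
  above-positive (step _ 0<q _ _) = 0<q

  abstract
    solve-step : ∀ q → 0ℚ ℚ.< q → ∀ d → ∃[ r ] (r ℚ.+ d) ℚ.* q ≡ n
    solve-step q 0<q d = let y , yq≡n = quotient n q 0<q in
      y ℚ.- d , trans (cong (ℚ._* q) ([q-d]+d≡q y d)) yq≡n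

    unsolve-step : ∀ r → 0ℚ ℚ.< r → ∃[ q ] 0ℚ ℚ.< q × r ℚ.* q ≡ n
    unsolve-step r 0<r = let q , qr≡n = quotient n r 0<r in
      q , positive-factor 0<n 0<r qr≡n , trans (ℚ.*-comm r q) qr≡n

  solve-step-decreasing : ∀ {d r s} → 0ℚ ℚ.< p → p ℚ.< q →
    (s ℚ.+ d) ℚ.* p ≡ n → (r ℚ.+ d) ℚ.* q ≡ n → r ℚ.< s
  solve-step-decreasing {d = d} 0<p p<q eqp eqq =
    +-cancelʳ-<ℚ d (hyperbola-decreasing 0<n 0<p p<q eqq eqp)

  unsolve-step-decreasing : ∀ {d r s} → 0ℚ ℚ.< r ℚ.+ d → r ℚ.< s →
    (r ℚ.+ d) ℚ.* p ≡ n → (s ℚ.+ d) ℚ.* q ≡ n → q ℚ.< p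
  unsolve-step-decreasing {p} {q} {d} {r} {s} 0<r r<s eqr eqs = hyperbola-decreasing 0<n 0<r
    (ℚ.+-monoˡ-< d r<s) (trans (ℚ.*-comm q (s ℚ.+ d)) eqs) (trans (ℚ.*-comm p (r ℚ.+ d)) eqr)

  mutual
    -- The map sending q to N/q - a₀ reverses order, so closure of one cut reduces to closure of the
    -- opposite cut of the tail.
    below-closed : p ℚ.< q → Below a q → Below a p
    below-closed {p} p<q (nonpositive q≤0) = nonpositive (ℚ.≤-trans (ℚ.<⇒≤ p<q) q≤0)
    below-closed {p} {a = a} p<q (step r 0<q eq above) with 0ℚ ℚ.<? p
    ... | no  0≮p = nonpositive (ℚ.≮⇒≥ 0≮p)
    ... | yes 0<p = let s , eqs = solve-step p 0<p (ℕ→ℚ (a 0)) in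
      step s 0<p eqs (above-closed (solve-step-decreasing {d = ℕ→ℚ (a 0)} 0<p p<q eqs eq) above)

    above-closed : p ℚ.< q → Above a p → Above a q
    above-closed p<q (one≤ 1≤p) = one≤ (ℚ.≤-trans 1≤p (ℚ.<⇒≤ p<q))
    above-closed {p} {q} {a} p<q (step r 0<p eq below) = let s , eqs = solve-step q 0<q (ℕ→ℚ (a 0)) in
      step s 0<q eqs (below-closed (solve-step-decreasing {d = ℕ→ℚ (a 0)} 0<p p<q eq eqs) below)
      where
      0<q : 0ℚ ℚ.< q
      0<q = ℚ.<-trans 0<p p<q

  Digits : (ℕ → ℕ) → Set
  Digits a = ∀ n → N ≤ a n

  -- The number N / (1 + a₀) serves, because 1 is above the tail.
  below-some : ∀ a → ∃[ q ] 0ℚ ℚ.< q × Below a q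
  below-some a = let q , 0<q , eq = unsolve-step (1ℚ ℚ.+ ℕ→ℚ (a 0)) (0<r+d (a 0) (ℚ.positive⁻¹ 1ℚ)) in
    q , 0<q , step 1ℚ 0<q eq (one≤ ℚ.≤-refl)

  n<r+d : ∀ {r d} → 0ℚ ℚ.< r → N ≤ d → n ℚ.< r ℚ.+ ℕ→ℚ d
  n<r+d {r} {d} 0<r N≤d = subst (ℚ._< r ℚ.+ ℕ→ℚ d) (ℚ.+-identityˡ n) (ℚ.+-mono-<-≤ 0<r (ℕ→ℚ-mono-≤ N≤d))

  mutual
    below-open : Digits a → Below a q → ∃[ p ] q ℚ.< p × Below a p
    below-open {a} N≤a (nonpositive q≤0) = let p , 0<p , below = below-some a in p , ℚ.≤-<-trans q≤0 0<p , below
    below-open {a} {q} N≤a (step r 0<q eq above) =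
      let r′ , r′<r , above′ = above-open (N≤a ∘ suc) above
          0<r′+a = 0<r+d (a 0) (above-positive above′)
          p , 0<p , eqp = unsolve-step (r′ ℚ.+ ℕ→ℚ (a 0)) 0<r′+a
      in p , unsolve-step-decreasing {d = ℕ→ℚ (a 0)} 0<r′+a r′<r eqp eq , step r′ 0<p eqp above′

    above-open : Digits a → Above a q → ∃[ p ] p ℚ.< q × Above a p
    above-open {a} {q} N≤a (one≤ 1≤q) =
      -- A positive r below the tail makes N / (r + a₀) a point above x, and it is less than 1 since
      -- a₀ ≥ N.
      let r , 0<r , below = below-some (a ∘ suc)
          p , 0<p , eqp = unsolve-step (r ℚ.+ ℕ→ℚ (a 0)) (0<r+d (a 0) 0<r)
          p<1 : p ℚ.< 1ℚ
          p<1 = *-cancel-< {r ℚ.+ ℕ→ℚ (a 0)} {p} {1ℚ} (0<r+d (a 0) 0<r) (subst₂ ℚ._<_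
                  (trans (sym eqp) (ℚ.*-comm (r ℚ.+ ℕ→ℚ (a 0)) p))
                  (sym (ℚ.*-identityˡ (r ℚ.+ ℕ→ℚ (a 0)))) (n<r+d 0<r (N≤a 0)))
      in p , ℚ.<-≤-trans p<1 1≤q , step r 0<p eqp below
    above-open {a} {q} N≤a (step r 0<q eq below) =
      let r′ , r<r′ , below′ = below-open (N≤a ∘ suc) below
          0<r+a = positive-factor {r ℚ.+ ℕ→ℚ (a 0)} {q} 0<n 0<q eq
          0<r′+a = ℚ.<-trans 0<r+a (ℚ.+-monoˡ-< (ℕ→ℚ (a 0)) r<r′)
          p , 0<p , eqp = unsolve-step (r′ ℚ.+ ℕ→ℚ (a 0)) 0<r′+a
      in p , unsolve-step-decreasing {d = ℕ→ℚ (a 0)} 0<r+a r<r′ eq eqp , step r′ 0<p eqp below′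

  -- Two derivations for one rational q descend in parallel, since (r + a₀) q = N determines r. A
  -- step cannot meet `one≤`, as q ≥ 1 and r > 0 would give (r + a₀) q > N. The equality is an
  -- argument because the two values of r are only provably equal.
  below-above : Digits a → Below a p → Above a q → p ≡ q → ⊥
  below-above N≤a (nonpositive q≤0) above refl = ℚ.<-irrefl refl (ℚ.<-≤-trans (above-positive above) q≤0)
  below-above {a} {q = q} N≤a (step r 0<q eq above) (one≤ 1≤q) refl =
    ℚ.<-irrefl refl (ℚ.<-≤-trans (n<r+d (above-positive above) (N≤a 0)) (begin
      r ℚ.+ ℕ→ℚ (a 0)               ≡⟨ ℚ.*-identityˡ _ ⟨
      1ℚ ℚ.* (r ℚ.+ ℕ→ℚ (a 0))      ≤⟨ ℚ.*-monoʳ-≤-nonNeg (r ℚ.+ ℕ→ℚ (a 0)) {{ℚ.nonNegative (ℚ.<⇒≤ 0<r+a)}} 1≤q ⟩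
      q ℚ.* (r ℚ.+ ℕ→ℚ (a 0))       ≡⟨ ℚ.*-comm q _ ⟩
      (r ℚ.+ ℕ→ℚ (a 0)) ℚ.* q       ≡⟨ eq ⟩
      n                             ∎))
    where
    open ℚ.≤-Reasoning
    0<r+a : 0ℚ ℚ.< r ℚ.+ ℕ→ℚ (a 0)
    0<r+a = positive-factor {r ℚ.+ ℕ→ℚ (a 0)} {q} 0<n 0<q eq
  below-above {a} {q = q} N≤a (step r 0<q eq above) (step s _ eq′ below) refl =
    below-above (N≤a ∘ suc) below above (sym r≡s)
    where
    r+d≡s+d : r ℚ.+ ℕ→ℚ (a 0) ≡ s ℚ.+ ℕ→ℚ (a 0)
    r+d≡s+d = ℚ.≤-antisym
      (*-cancel-≤ {r ℚ.+ ℕ→ℚ (a 0)} {s ℚ.+ ℕ→ℚ (a 0)} (ℚ.≤-reflexive (trans eq (sym eq′))))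
      (*-cancel-≤ {s ℚ.+ ℕ→ℚ (a 0)} {r ℚ.+ ℕ→ℚ (a 0)} (ℚ.≤-reflexive (trans eq′ (sym eq))))
      where
      *-cancel-≤ : ∀ {x y} → x ℚ.* q ℚ.≤ y ℚ.* q → x ℚ.≤ y
      *-cancel-≤ = ℚ.*-cancelʳ-≤-pos q {{ℚ.positive 0<q}}
    r≡s : r ≡ s
    r≡s = trans (sym ([q+d]-d≡q r (ℕ→ℚ (a 0)))) (trans (cong (ℚ._- ℕ→ℚ (a 0)) r+d≡s+d)
      ([q+d]-d≡q s (ℕ→ℚ (a 0))))

  -- Euclid's algorithm: the denominator decreases at every step.
  below⊎above : ∀ a q → Below a q ⊎ Above a q
  below⊎above a q = let i , eq = fraction q in <-rec Decided decide (ℚ.↧ₙ q) (s≤s z≤n) a q i eq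
    where
    Decided : ℕ → Set
    Decided k = 0 < k → ∀ a q i → q ℚ.* ℕ→ℚ k ≡ ι i → Below a q ⊎ Above a q
    decide : ∀ k → (∀ {m} → m < k → Decided m) → Decided k
    decide k rec 0<k a q i eq with 0ℚ ℚ.<? q | 1ℚ ℚ.≤? q
    ... | no  0≮q | _       = inj₁ (nonpositive (ℚ.≮⇒≥ 0≮q))
    ... | yes _   | yes 1≤q = inj₂ (one≤ 1≤q)
    ... | yes 0<q | no 1≰q with r , eqr ← solve-step q 0<q (ℕ→ℚ (a 0)) =
      -- Positivity of q makes the numerator a positive natural m, and q < 1 makes m < k. This m is
      -- the denominator for r.
      go i eq (ι-cancel-< {0ℤ} {i} (subst (0ℚ ℚ.<_) eq 0<qk))
      where
      0<ιk : 0ℚ ℚ.< ℕ→ℚ k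
      0<ιk = ℕ→ℚ-positive k {{>-nonZero 0<k}}
      0<qk : 0ℚ ℚ.< q ℚ.* ℕ→ℚ k
      0<qk = subst (ℚ._< q ℚ.* ℕ→ℚ k) (ℚ.*-zeroˡ (ℕ→ℚ k)) (*-mono-< 0<ιk 0<q)
      go : ∀ i → q ℚ.* ℕ→ℚ k ≡ ι i → 0ℤ ℤ.< i → Below a q ⊎ Above a q
      go (ℤ.+ m) eq (ℤ.+<+ 0<m) =
        [ inj₂ ∘ step r 0<q eqr , inj₁ ∘ step r 0<q eqr ]′
          (rec m<k 0<m (a ∘ suc) r (ℤ.+ (N * k) ℤ.- ℤ.+ (a 0 * m)) remainder)
        where
        m<k : m < k
        m<k = ℤ.drop‿+<+ (ι-cancel-< (subst₂ ℚ._<_ eq (ℚ.*-identityˡ (ℕ→ℚ k)) (*-mono-< 0<ιk (ℚ.≰⇒> 1≰q))))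
        remainder : r ℚ.* ℕ→ℚ m ≡ ι (ℤ.+ (N * k) ℤ.- ℤ.+ (a 0 * m))
        remainder = euclid-step r (ℕ→ℚ (a 0)) q (ℕ→ℚ k) n (ℕ→ℚ m) (ι (ℤ.+ (N * k) ℤ.- ℤ.+ (a 0 * m)))
          eqr eq (ι-remainder N k (a 0) m)

  fromDigits : ∀ a → Digits a → 𝕀
  fromDigits a N≤a = record
    { value      = cut
    ; irrational = compare⇒irrational cut (below⊎above a)
    ; 0≤value    = λ q q<0 → nonpositive (ℚ.<⇒≤ q<0)
    ; value≤1    = λ q below → lower<upper cut below (one≤ ℚ.≤-refl)
    }
    where
    cut : ℝ
    cut = record
      { lower           = Below a
      ; upper           = Above a
      ; lower-inhabited = 0ℚ , nonpositive ℚ.≤-refl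
      ; upper-inhabited = 1ℚ , one≤ ℚ.≤-refl
      ; lower-closed    = below-closed
      ; upper-closed    = above-closed
      ; lower-open      = below-open N≤a
      ; upper-open      = above-open N≤a
      ; disjoint        = λ below above → below-above N≤a below above refl
      ; located         = λ {p} {q} p<q → map₂ (λ p-above → above-closed p<q p-above) (below⊎above a p)
      }

  -- Floors and digits respect equality of reals

  open ℝ
  open 𝕀

  _≃_ : 𝕀 → 𝕀 → Set
  x ≃ y = value x ≃ᴿ value y

  -- The order speaks of lower cuts only; irrationality of `x` places every rational in one of its
  -- two cuts, which transfers it to upper cuts.
  ≤ᴿ⇒upper : ∀ x y → value x ≤ᴿ value y → ∀ {q} → upper (value y) q → upper (value x) q
  ≤ᴿ⇒upper x y x≤y {q} u with compare {value x} (irrational x) q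
  ... | inj₁ l  = ⊥-elim (disjoint (value y) (x≤y q l) u)
  ... | inj₂ u′ = u′

  -- The cuts of the irrational `x` exhaust the rationals, so including them in the disjoint cuts of
  -- `y` already forces equality.
  ⊆⇒≃ : ∀ x y → (∀ {q} → lower (value x) q → lower (value y) q) →
    (∀ {q} → upper (value x) q → upper (value y) q) → y ≃ x
  ⊆⇒≃ x y low upp = y≤x , λ q → low
    where
    y≤x : value y ≤ᴿ value x
    y≤x q l with compare {value x} (irrational x) q
    ... | inj₁ l′ = l′
    ... | inj₂ u  = ⊥-elim (disjoint (value y) l (upp u))

  quot-antitone : ∀ x y → value x ≤ᴿ value y → quot N y ≤ᴿ quot N x
  quot-antitone x y x≤y q (r , u , qr<n) = r , ≤ᴿ⇒upper x y x≤y u , qr<n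

  -- If e < d, a rational just below e + 1 and above z would also lie below y. With equal reals this
  -- gives uniqueness of the floor.
  floor-mono : ∀ y z {d e} → fromℚ (ℕ→ℚ d) ≤ᴿ y → y ≤ᴿ z → z <ᴿ fromℚ (ℕ→ℚ (suc e)) → d ≤ e
  floor-mono y z {d} {e} d≤y y≤z z<1+e = ≮⇒≥ λ e<d →
    let s , s<1+e , u = upper-open z (<⇒upper z z<1+e)
    in disjoint z (y≤z s (d≤y s (ℚ.<-≤-trans s<1+e (ℕ→ℚ-mono-≤ e<d)))) u

  ⌊N/⌋-cong : ∀ x y → x ≃ y → ⌊N/_⌋ N x ≡ ⌊N/_⌋ N y
  ⌊N/⌋-cong x y (x≤y , y≤x) = ≤-antisym (half x y y≤x) (half y x x≤y)
    where
    half : ∀ x y → value y ≤ᴿ value x → ⌊N/_⌋ N x ≤ ⌊N/_⌋ N y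
    half x y y≤x = floor-mono (quot N x) (quot N y) (proj₁ (proj₂ (quot-floor N x)))
      (quot-antitone y x y≤x) (proj₂ (proj₂ (quot-floor N y)))

  T-cong : ∀ x y → x ≃ y → T N x ≃ T N y
  T-cong x y x≃y@(x≤y , y≤x) = half x y x≃y , half y x (y≤x , x≤y)
    where
    half : ∀ x y → x ≃ y → value (T N x) ≤ᴿ value (T N y)
    half x y x≃y@(_ , y≤x) q l = subst (λ d → lower (quot N y) (q ℚ.+ ℕ→ℚ d)) (⌊N/⌋-cong x y x≃y)
      (quot-antitone y x y≤x (q ℚ.+ ℕ→ℚ (⌊N/_⌋ N x)) l)

  digit-cong : ∀ x y → x ≃ y → ∀ k → digit N x k ≡ digit N y k
  digit-cong x y x≃y k = ⌊N/⌋-cong (fold x (T N) k) (fold y (T N) k)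
    (fold-preserves (T N) _≃_ T-cong {x} {y} x≃y k)

  N≤⌊N/⌋ : ∀ x → N ≤ ⌊N/_⌋ N x
  N≤⌊N/⌋ x = floor-mono (quot N x) (quot N x) n≤N/x (λ _ l → l) (proj₂ (proj₂ (quot-floor N x)))
    where
    1-upper : upper (value x) 1ℚ
    1-upper with compare {value x} (irrational x) 1ℚ
    ... | inj₁ l = ⊥-elim (ℚ.<-irrefl refl (value≤1 x 1ℚ l))
    ... | inj₂ u = u
    n≤N/x : fromℚ n ≤ᴿ quot N x
    n≤N/x q q<n = 1ℚ , 1-upper , subst (ℚ._< n) (sym (ℚ.*-identityʳ q)) q<n

  N≤digit : ∀ x k → N ≤ digit N x k
  N≤digit x k = N≤⌊N/⌋ (fold x (T N) k)

  -- Digits of the constructed irrationals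

  module _ (a : ℕ → ℕ) (N≤a : Digits a) where

    private
      module Q = Reciprocal N (value (fromDigits a N≤a)) (0<value (fromDigits a N≤a))

    -- If q + a₀ is positive, N / (q + a₀) lies above x and witnesses q + a₀ < N/x. Otherwise q + a₀
    -- ≤ 0 is below N/x anyway.
    quot-below : ∀ {q} → Below (a ∘ suc) q → lower (quot N (fromDigits a N≤a)) (q ℚ.+ ℕ→ℚ (a 0))
    quot-below {q} below with 0ℚ ℚ.<? q ℚ.+ ℕ→ℚ (a 0)
    ... | no  0≮q+a = Q.low-nonpos (ℚ.≮⇒≥ 0≮q+a)
    ... | yes 0<q+a with s , 0<s , eq ← unsolve-step (q ℚ.+ ℕ→ℚ (a 0)) 0<q+a =
      Q.low 0<q+a (trans (ℚ.*-comm s _) eq) (step q 0<s eq below)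

    quot-above : ∀ {q} → Above (a ∘ suc) q → upper (quot N (fromDigits a N≤a)) (q ℚ.+ ℕ→ℚ (a 0))
    quot-above {q} above with 0<q+a ← 0<r+d (a 0) (above-positive above)
      with s , 0<s , eq ← unsolve-step (q ℚ.+ ℕ→ℚ (a 0)) 0<q+a =
      Q.upp 0<q+a (trans (ℚ.*-comm s _) eq) (step q 0<s eq above)

    -- The base cases of the tail's cut, 0 below and 1 above, become a₀ ≤ N/x < 1 + a₀.
    ⌊N/fromDigits⌋ : ⌊N/_⌋ N (fromDigits a N≤a) ≡ a 0
    ⌊N/fromDigits⌋ = ≤-antisym
        (floor-mono (quot N (fromDigits a N≤a)) (quot N (fromDigits a N≤a))
          (proj₁ (proj₂ (quot-floor N (fromDigits a N≤a)))) (λ _ l → l) N/x<1+a₀)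
        (floor-mono (quot N (fromDigits a N≤a)) (quot N (fromDigits a N≤a))
          a₀≤N/x (λ _ l → l) (proj₂ (proj₂ (quot-floor N (fromDigits a N≤a)))))
      where
      a₀≤N/x : fromℚ (ℕ→ℚ (a 0)) ≤ᴿ quot N (fromDigits a N≤a)
      a₀≤N/x q q<a₀ = subst (lower (quot N (fromDigits a N≤a))) ([q-d]+d≡q q (ℕ→ℚ (a 0)))
        (quot-below {q ℚ.- ℕ→ℚ (a 0)} (nonpositive (ℚ.<⇒≤ (+-cancelʳ-<ℚ (ℕ→ℚ (a 0))
          (subst₂ ℚ._<_ (sym ([q-d]+d≡q q (ℕ→ℚ (a 0)))) (sym (ℚ.+-identityˡ (ℕ→ℚ (a 0)))) q<a₀)))))
      N/x<1+a₀ : quot N (fromDigits a N≤a) <ᴿ fromℚ (ℕ→ℚ (suc (a 0)))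
      N/x<1+a₀ = upper⇒< (quot N (fromDigits a N≤a))
        (subst (upper (quot N (fromDigits a N≤a))) (sym (ℕ→ℚ-suc (a 0))) (quot-above (one≤ ℚ.≤-refl)))

    T-fromDigits : T N (fromDigits a N≤a) ≃ fromDigits (a ∘ suc) (N≤a ∘ suc)
    T-fromDigits = ⊆⇒≃ (fromDigits (a ∘ suc) (N≤a ∘ suc)) (T N (fromDigits a N≤a))
      (λ {q} below → subst (λ d → lower (quot N (fromDigits a N≤a)) (q ℚ.+ ℕ→ℚ d))
        (sym ⌊N/fromDigits⌋) (quot-below below))
      (λ {q} above → subst (λ d → upper (quot N (fromDigits a N≤a)) (q ℚ.+ ℕ→ℚ d))
        (sym ⌊N/fromDigits⌋) (quot-above above))

  digit-fromDigits : ∀ a N≤a k → digit N (fromDigits a N≤a) k ≡ a k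
  digit-fromDigits a N≤a k = fold-itinerary (T N) (⌊N/_⌋ N) _≃_ T-cong ⌊N/⌋-cong
    Digits (_∘ suc) fromDigits ⌊N/fromDigits⌋ T-fromDigits k a N≤a

  -- Cantor's diagonal: digit `k` of the new point avoids digit `k` of `f k`, using only `m` and
  -- `suc m`. Since digits depend only on the real number, by `digit-cong`, a differing digit
  -- separates the two reals.
  uncountablyMany : ∀ {P : 𝕀 → Set} m → N ≤ m → (∀ x → (∀ k → m ≤ digit N x k) → P x) → UncountablyMany P
  uncountablyMany {P} m N≤m large f =
    missed (fromDigits diagonal N≤diagonal) (digit-fromDigits diagonal N≤diagonal)
    where
    diagonal : ℕ → ℕ
    diagonal k = other m (digit N (f k) k)
    N≤diagonal : Digits diagonal
    N≤diagonal k = ≤-trans N≤m (m≤other m _)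
    missed : ∀ x → (∀ k → digit N x k ≡ diagonal k) →
      Σ[ x ∈ 𝕀 ] P x × (∀ k → ¬ (value x ≃ᴿ value (f k)))
    missed x digit≡ = x ,
      large x (λ k → subst (m ≤_) (sym (digit≡ k)) (m≤other m _)) ,
      λ k x≃fk → other-≢ m (digit N (f k) k) (trans (sym (digit≡ k)) (digit-cong x (f k) x≃fk k))

corollary4p5 : (N : ℕ) .{{_ : NonZero N}} →
    ((∀ (x : 𝕀) → TheWord (IsDualNCFSequence N x) (Balanced N)) ×
    (2 ≤ N → UncountablyMany (λ x → TheWord (IsDualNCFSequence N x) (Balanced 2)))) ×
    ((∀ (x : 𝕀) → TheWord (IsNCFSequence N x) (Balanced (N ^ 2))) ×
    (2 ≤ N → UncountablyMany (λ x → TheWord (IsNCFSequence N x) (Balanced (2 * N)))))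
corollary4p5 N =
  ( (λ x → σ̂-N-balanced N (digit N x) (N≤digit N x))
  , λ _ → uncountablyMany N {λ x → TheWord (IsDualNCFSequence N x) (Balanced 2)}
      (2 * N) (m≤m+n N (1 * N)) (λ x → σ̂-2-balanced N (digit N x)) ) ,
  ( (λ x → σ-N²-balanced N (digit N x) (N≤digit N x))
  , λ _ → uncountablyMany N {λ x → TheWord (IsNCFSequence N x) (Balanced (2 * N))}
      (2 * N) (m≤m+n N (1 * N)) (λ x → σ-2N-balanced N (digit N x)) )
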